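{- Let $k\geq 3$. For $n\geq 0$ let $f_k(n)$ be the number of $321$-$k$-gon-avoiding permutations in $S_n$ (with $f_k(0)=1$), and for $s\geq 1$ set $$L_n^k(s)=\sum_{j=0}^{s}(-1)^j\binom{s-j}{j}f_k(n-j).$$ Then for all $n\geq 2k$, $$L_n^k(2k-2)=L_{n-1}^k(2k-2)+L_{n-3}^k(2k-5)+L_{n-3}^k(2k-4)+L_{n-4}^k(2k-5)+L_{n-4}^k(2k-4).$$
   Context: A permutation $\alpha\in S_n$ contains a pattern $\tau\in S_m$ if there are indices $i_1<\dots<i_m$ such that $(\alpha_{i_1},\dots,\alpha_{i_m})$ is order-isomorphic to $\tau$; otherwise $\alpha$ avoids $\tau$. For $k\geq 2$, a permutation is $k$-gon-avoiding if it avoids each of the four patterns (written in one-line notation, entries separated by commas) $(k,k+2,k+3,\dots,2k-1,1,2k,2,3,\dots,k+1)$, $(k,k+2,k+3,\dots,2k-1,2k,1,2,3,\dots,k+1)$, $(k+1,k+2,k+3,\dots,2k-1,1,2k,2,3,\dots,k)$, $(k+1,k+2,k+3,\dots,2k-1,2k,1,2,3,\dots,k)$. A permutation is $321$-$k$-gon-avoiding if it is $k$-gon-avoiding and avoids $321$.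
   Formalization: In the first two patterns the final block "2,3,…,k+1" is read as 2,3,…,k−1,k+1 (the value k omitted), since as written k would occur twice and the pattern would not be a permutation of 1,…,2k. -}

module Defs where

open import Data.Bool using (Bool; true; false; _∧_; _∨_; not; if_then_else_)
open import Data.Nat using (ℕ; zero; suc; _+_; _*_; _∸_; _<ᵇ_; _≡ᵇ_)
open import Data.Nat.Combinatorics using (_C_)
open import Data.List using (List; []; _∷_; _++_; [_]; map; length; filter; upTo; concatMap; zip; foldr)
open import Data.Product using (_,_; _×_)
open import Data.Integer as ℤ using (ℤ; +_)
open import Relation.Nullary.Decidable using (Dec; yes; no)
open import Relation.Binary.PropositionalEquality using (_≡_)
open import Data.Bool using (T)
open import Data.Bool.Properties using (T?)

-- Permutations of S_n are written in one-line notation as lists of ℕ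
-- with entries in {1,...,n}.

-- inclusive range [a .. b] (empty if b < a)
range : ℕ → ℕ → List ℕ
range a b = map (λ i → a + i) (upTo (suc b ∸ a))

allB : {A : Set} → (A → Bool) → List A → Bool
allB p = foldr (λ x r → p x ∧ r) true

anyB : {A : Set} → (A → Bool) → List A → Bool
anyB p = foldr (λ x r → p x ∨ r) false

_⇔ᵇ_ : Bool → Bool → Bool
true ⇔ᵇ b = b
false ⇔ᵇ b = not b

orderIso : List ℕ → List ℕ → Bool
orderIso [] [] = true
orderIso [] (_ ∷ _) = false
orderIso (_ ∷ _) [] = false
orderIso (x ∷ xs) (y ∷ ys) =
  allB (λ { (z , w) → ((x <ᵇ z) ⇔ᵇ (y <ᵇ w)) ∧ ((z <ᵇ x) ⇔ᵇ (w <ᵇ y)) }) (zip xs ys)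
  ∧ (length xs ≡ᵇ length ys) ∧ orderIso xs ys

subseqs : List ℕ → List (List ℕ)
subseqs [] = [] ∷ []
subseqs (x ∷ xs) = map (x ∷_) (subseqs xs) ++ subseqs xs

containsᵇ : List ℕ → List ℕ → Bool
containsᵇ α τ = anyB (λ s → orderIso s τ) (subseqs α)

avoidsᵇ : List ℕ → List ℕ → Bool
avoidsᵇ α τ = not (containsᵇ α τ)

-- the four k-gon patterns (permutations of {1..2k}); in the first two the
-- final block "2,3,...,k+1" skips the value k, which already occurs first
pat1 pat2 pat3 pat4 : ℕ → List ℕ
pat1 k = [ k ] ++ range (k + 2) (2 * k ∸ 1) ++ (1 ∷ 2 * k ∷ []) ++ range 2 (k ∸ 1) ++ [ k + 1 ]
pat2 k = [ k ] ++ range (k + 2) (2 * k) ++ [ 1 ] ++ range 2 (k ∸ 1) ++ [ k + 1 ]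
pat3 k = range (k + 1) (2 * k ∸ 1) ++ (1 ∷ 2 * k ∷ []) ++ range 2 k
pat4 k = range (k + 1) (2 * k) ++ [ 1 ] ++ range 2 k

kGonAvoidingᵇ : ℕ → List ℕ → Bool
kGonAvoidingᵇ k α =
  avoidsᵇ α (pat1 k) ∧ avoidsᵇ α (pat2 k) ∧ avoidsᵇ α (pat3 k) ∧ avoidsᵇ α (pat4 k)

321-kGonAvoidingᵇ : ℕ → List ℕ → Bool
321-kGonAvoidingᵇ k α = kGonAvoidingᵇ k α ∧ avoidsᵇ α (3 ∷ 2 ∷ 1 ∷ [])

words : ℕ → List ℕ → List (List ℕ)
words zero A = [] ∷ []
words (suc m) A = concatMap (λ a → map (a ∷_) (words m A)) A

distinctᵇ : List ℕ → Bool
distinctᵇ [] = true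
distinctᵇ (x ∷ xs) = allB (λ y → not (x ≡ᵇ y)) xs ∧ distinctᵇ xs

perms : ℕ → List (List ℕ)
perms n = filter (λ w → T? (distinctᵇ w)) (words n (range 1 n))

f : ℕ → ℕ → ℕ
f k n = length (filter (λ α → T? (321-kGonAvoidingᵇ k α)) (perms n))

sumTo : ℕ → (ℕ → ℤ) → ℤ
sumTo zero g = g 0
sumTo (suc s) g = sumTo s g ℤ.+ g (suc s)

sign : ℕ → ℤ
sign zero = + 1
sign (suc j) = ℤ.- sign j

L : ℕ → ℕ → ℕ → ℤ
L k n s = sumTo s (λ j → sign j ℤ.* (+ ((s ∸ j) C j)) ℤ.* (+ f k (n ∸ j)))

{-# OPTIONS --safe #-}

-- A permutation avoiding 321 is a shuffle of two increasing sequences: its left-to-right maxima and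
-- the other entries. Recording for each i whether position i and value i belong to a maximum turns it
-- into a lattice path with up, down and two kinds of flat steps, whose height after i steps is the
-- number of maxima among the first i positions minus the number among the first i values. The
-- permutation contains one of the four patterns iff its heap contains a k × k diamond, possibly without
-- the top and bottom cells; this is a condition on two consecutive steps of the path. Put K = k - 1.
-- The avoiders are thus the paths of height at most K with some restrictions at height K. Summing over
-- the first step, the number of completions with m steps from a height h ≤ K satisfies the Chebyshev
-- recurrence, hence equals L k (m + h) (2h). If t(m) counts the completions from height K and b(m)
-- those that have just stepped down from K, the claim becomes t(m+2) = t(m+1) + b(m+1) + b(m).

module Submission where

open import Defs
open import Data.Bool using (Bool; true; false; T; not; _∧_)
open import Data.Bool.Properties using (T?; T-∧; T-∨)
open import Data.Empty using (⊥; ⊥-elim)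
open import Data.Integer as ℤ using (ℤ; +_)
import Data.Integer.Properties as ℤₚ
import Data.Integer.Tactic.RingSolver as IntSolver
open import Data.List using (List; []; _∷_; map; length; filter; concatMap; _++_; applyUpTo; drop; _∷ʳ_; zip; take)
open import Data.List.Membership.Propositional using (_∈_)
open import Data.List.Membership.Propositional.Properties using (∈-map⁺; ∈-map⁻; ∈-++⁺ˡ; ∈-++⁺ʳ; ∈-++⁻; ∈-∃++; ∈-filter⁺; ∈-filter⁻)
open import Data.List.Membership.Propositional.Properties.WithK using (unique∧set⇒bag)
open import Data.List.Properties using (length-map; length-++; filter-accept; filter-reject; filter-all; ++-assoc; ++-identityʳ; ∷-injective; ∷-injectiveˡ; ∷-injectiveʳ; map-++; ∷ʳ-injective; take++drop≡id; length-take)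
open import Data.List.Relation.Binary.BagAndSetEquality using (∼bag⇒↭)
open import Data.List.Relation.Binary.Permutation.Propositional using (_↭_; ↭-refl; ↭-sym; ↭-trans; ↭⇒↭ₛ; prep)
open import Data.List.Relation.Binary.Permutation.Propositional.Properties using (∈-resp-↭; ↭-length; shift; drop-∷; ↭-empty-inv)
import Data.List.Relation.Binary.Permutation.Setoid.Properties as Permₛ
open import Data.List.Relation.Binary.Sublist.Heterogeneous.Properties using (length-mono-≤) renaming (++⁺ to ⊆-++⁺; ++ˡ to ⊆-++ˡ; ++ʳ to ⊆-++ʳ)
import Data.List.Relation.Binary.Sublist.Propositional as Sublist
open import Data.List.Relation.Binary.Sublist.Propositional using (_⊆_; []; _∷_; ⊆-trans; from∈; ⊆-refl)
import Data.List.Relation.Binary.Sublist.Propositional.Properties as Sublistₚ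
open import Data.List.Relation.Binary.Sublist.Propositional.Properties using (All-resp-⊆)
open import Data.List.Relation.Unary.All as All using (All; []; _∷_)
import Data.List.Relation.Unary.All.Properties as Allₚ
open import Data.List.Relation.Unary.AllPairs as AllPairs using (AllPairs; []; _∷_)
import Data.List.Relation.Unary.AllPairs.Properties as AllPairsₚ
open import Data.List.Relation.Unary.Any using (here; there)
open import Data.List.Relation.Unary.Unique.Propositional using (Unique)
import Data.List.Relation.Unary.Unique.Propositional.Properties as Uniqueₚ
open import Data.Nat using (ℕ; zero; suc; pred; _+_; _*_; _∸_; _≤_; _<_; z≤n; s≤s; _≤?_; _<?_; _≡ᵇ_; _<ᵇ_; _⊔_)
open import Data.Nat.Combinatorics using (_C_; nCk+nC[k+1]≡[n+1]C[k+1]; k>n⇒nCk≡0)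
open import Data.Nat.Properties
import Data.Nat.Tactic.RingSolver as NatSolver
open import Data.Product using (_×_; _,_; proj₁; proj₂; ∃; ∃₂)
open import Data.Sum using (_⊎_; inj₁; inj₂)
open import Data.Unit using (tt)
open import Function using (_∘_; Equivalence; mk⇔)
open import Relation.Binary.Definitions using (tri<; tri≈; tri>)
open import Relation.Binary.PropositionalEquality using (_≡_; refl; sym; trans; cong; cong₂; subst; module ≡-Reasoning; _≢_; setoid; subst₂)
open import Relation.Nullary using (¬_; Dec; yes; no; contradiction)
open import Relation.Nullary.Decidable using (¬?; _×-dec_)

-- Paths

-- Let E(1) < E(2) < ... be the maxima and D(1) < D(2) < ... the other entries of an avoider of 321.
-- It contains one of the four patterns iff for some q and r four comparisons hold: E(q+K) stands
-- left of D(r+1), E(q+k) stands left of D(r+2), D(r+K) < E(q+1) and D(r+k) < E(q+2). The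
-- comparisons left open, E(q+k) with D(r+1) by position and E(q+1) with D(r+k) by value, are
-- exactly those in which the four patterns differ. Now E(q+K) stands left of D(r+1) iff at least q
-- + K of the first i = q + K + r entries are maxima, and D(r+K) < E(q+1) iff at most q of the first
-- i values are. The other two comparisons say the same for q + 1 and r + 1, hence at i + 2. So all
-- four conditions are read off at i and i + 2, and once i is fixed only q remains to be chosen;
-- eliminating it gives the inequalities of `Bad`.

data Step : Set where
  up down flatE flatD : Step

-- The i-th step of the path of a permutation records whether position i and value i
-- belong to left-to-right maxima (true) or not (false).
posE valE : Step → Bool
posE up = true
posE down = false
posE flatE = true
posE flatD = false
valE up = false
valE down = true
valE flatE = true
valE flatD = false

bit : Bool → ℕ
bit true = 1
bit false = 0

move : ℕ → Step → ℕ
move g up = suc g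
move g down = pred g
move g flatE = g
move g flatD = g

-- K = k - 1. Write t, s for the numbers of maxima among the first j positions and values, so that
-- g = t - s; the four inequalities say that some q satisfies s ≤ q ≤ t - K and, two steps later
-- with t′, s′ in place of t, s, also s′ - 1 ≤ q ≤ t′ - K - 1.
Bad : (K g : ℕ) (x y : Step) → Set
Bad K g x y =
  K ≤ g
  × bit (valE x) + bit (valE y) + K ≤ bit (posE x) + bit (posE y) + g
  × suc K ≤ bit (posE x) + bit (posE y) + g
  × bit (valE x) + bit (valE y) + K ≤ suc g

abstract
  bad? : ∀ K g x y → Dec (Bad K g x y)
  bad? K g x y = (_ ≤? _) ×-dec (_ ≤? _) ×-dec (_ ≤? _) ×-dec (_ ≤? _)

-- At height 0 the positions passed so far hold exactly the values passed so far, so the next entry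
-- exceeds all earlier ones: it is a maximum, and only steps with `posE` true remain.
starts : ℕ → List Step
starts zero = up ∷ flatE ∷ []
starts (suc _) = up ∷ down ∷ flatE ∷ flatD ∷ []

-- Continuations by m further steps of a path whose last step x started at height g.
paths : (K g : ℕ) → Step → ℕ → List (List Step)
paths K g x (suc m) =
  concatMap (λ y → map (y ∷_) (paths K (move g x) y m)) (filter (¬? ∘ bad? K g x) (starts (move g x)))
paths K g x zero with move g x
... | zero = [] ∷ []
... | suc _ = []

#paths : (K g : ℕ) → Step → ℕ → ℕ
#paths K g x m = length (paths K g x m)

total : (Step → ℕ) → List Step → ℕ
total w [] = 0
total w (y ∷ ys) = w y + total w ys

length-extend : (P : Step → List (List Step)) (ys : List Step) →
  length (concatMap (λ y → map (y ∷_) (P y)) ys) ≡ total (λ y → length (P y)) ys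
length-extend P [] = refl
length-extend P (y ∷ ys) =
  trans (length-++ (map (y ∷_) (P y))) (cong₂ _+_ (length-map (y ∷_) (P y)) (length-extend P ys))

-- Completions from height h when the previous step imposes no restriction.
#free : (K h m : ℕ) → ℕ
#free K h (suc m) = total (λ y → #paths K h y m) (starts h)
#free K zero zero = 1
#free K (suc h) zero = 0

#paths-suc : ∀ K g x m →
  #paths K g x (suc m) ≡ total (λ y → #paths K (move g x) y m) (filter (¬? ∘ bad? K g x) (starts (move g x)))
#paths-suc K g x m = length-extend (λ y → paths K (move g x) y m) (filter (¬? ∘ bad? K g x) (starts (move g x)))

-- The first inequality of `Bad` fails below height K, so nothing is filtered out.
#paths-low : ∀ {K g} → g < K → ∀ x m → #paths K g x m ≡ #free K (move g x) m
#paths-low {K} {g} g<K x (suc m) = trans (#paths-suc K g x m)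
  (cong (total (λ y → #paths K (move g x) y m))
    (filter-all (¬? ∘ bad? K g x) (All.universal (λ y b → <⇒≱ g<K (proj₁ b)) (starts (move g x)))))
#paths-low {K} {g} g<K x zero with move g x
... | zero = refl
... | suc _ = refl

-- Steps taken at height K

module _ (K : ℕ) where

  private
    filter-no : ∀ x y {ys zs} → Bad K K x y → filter (¬? ∘ bad? K K x) ys ≡ zs →
      filter (¬? ∘ bad? K K x) (y ∷ ys) ≡ zs
    filter-no x y {ys} b eq = trans (filter-reject (¬? ∘ bad? K K x) {xs = ys} (λ ¬b → ¬b b)) eq

    filter-yes : ∀ x y {ys zs} → ¬ Bad K K x y → filter (¬? ∘ bad? K K x) ys ≡ zs →
      filter (¬? ∘ bad? K K x) (y ∷ ys) ≡ y ∷ zs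
    filter-yes x y {ys} ¬b eq = trans (filter-accept (¬? ∘ bad? K K x) {xs = ys} ¬b) (cong (y ∷_) eq)

    K≤K : K ≤ K
    K≤K = ≤-refl

    sK≤sK : suc K ≤ suc K
    sK≤sK = ≤-refl

    K≤sK : K ≤ suc K
    K≤sK = n≤1+n K

  filter-above : filter (¬? ∘ bad? K K up) (starts (suc K)) ≡ []
  filter-above =
    filter-no up up (K≤K , ≤-trans K≤sK (n≤1+n _) , n≤1+n _ , K≤sK)
      (filter-no up down (K≤K , sK≤sK , sK≤sK , sK≤sK)
      (filter-no up flatE (K≤K , n≤1+n _ , n≤1+n _ , sK≤sK)
      (filter-no up flatD (K≤K , K≤sK , sK≤sK , K≤sK) refl)))

  -- Every continuation of a step up from K is bad, and stopping at height K + 1 is not allowed.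
  -- This is how `Bad` bounds the height without mentioning a bound.
  #paths-above : ∀ m → #paths K K up m ≡ 0
  #paths-above zero = refl
  #paths-above (suc m) = trans (#paths-suc K K up m) (cong (total (λ y → #paths K (suc K) y m)) filter-above)

  filter-flatE : filter (¬? ∘ bad? K K flatE) (up ∷ down ∷ flatE ∷ flatD ∷ []) ≡ down ∷ flatE ∷ []
  filter-flatE =
    filter-no flatE up (K≤K , n≤1+n _ , n≤1+n _ , sK≤sK)
      (filter-yes flatE down (λ b → 1+n≰n (≤-pred (≤-trans (proj₁ (proj₂ b)) sK≤sK)))
      (filter-yes flatE flatE (λ b → 1+n≰n (≤-pred (proj₂ (proj₂ (proj₂ b)))))
      (filter-no flatE flatD (K≤K , sK≤sK , sK≤sK , sK≤sK) refl)))

  filter-flatD : filter (¬? ∘ bad? K K flatD) (up ∷ down ∷ flatE ∷ flatD ∷ []) ≡ down ∷ flatD ∷ []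
  filter-flatD =
    filter-no flatD up (K≤K , K≤sK , sK≤sK , K≤sK)
      (filter-yes flatD down (λ b → 1+n≰n (proj₁ (proj₂ (proj₂ b))))
      (filter-no flatD flatE (K≤K , sK≤sK , sK≤sK , sK≤sK)
      (filter-yes flatD flatD (λ b → 1+n≰n (proj₁ (proj₂ (proj₂ b)))) refl)))

  filter-down : filter (¬? ∘ bad? K K down) (up ∷ down ∷ flatE ∷ flatD ∷ []) ≡ down ∷ flatE ∷ flatD ∷ []
  filter-down =
    filter-no down up (K≤K , sK≤sK , sK≤sK , sK≤sK)
      (filter-yes down down (λ b → 1+n≰n (proj₁ (proj₂ (proj₂ b))))
      (filter-yes down flatE (λ b → 1+n≰n (≤-trans (proj₁ (proj₂ b)) sK≤sK))
      (filter-yes down flatD (λ b → 1+n≰n (proj₁ (proj₂ (proj₂ b)))) refl)))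

module _ (h : ℕ) where
  private K = suc (suc h)

  #paths-K-flatE : ∀ m → #paths K K flatE (suc m) ≡ #paths K K down m + (#paths K K flatE m + 0)
  #paths-K-flatE m = trans (#paths-suc K K flatE m) (cong (total (λ y → #paths K K y m)) (filter-flatE K))

  -- At height K a flat step can be followed only by `down` or by a flat step of its own kind, so
  -- the two kinds have the same completions up to renaming.
  #paths-K-flatD : ∀ m → #paths K K flatD m ≡ #paths K K flatE m
  #paths-K-flatD zero = refl
  #paths-K-flatD (suc m) =
    trans (trans (#paths-suc K K flatD m) (cong (total (λ y → #paths K K y m)) (filter-flatD K)))
      (trans (cong (λ c → #paths K K down m + (c + 0)) (#paths-K-flatD m)) (sym (#paths-K-flatE m)))

  -- After a step down from K only an immediate return upwards is bad. The next step starts at K - 1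
  -- and therefore restricts nothing further.
  #paths-K-down : ∀ m → #paths K K down (suc m) ≡ #free K h m + (#free K (suc h) m + (#free K (suc h) m + 0))
  #paths-K-down m =
    trans (trans (#paths-suc K K down m) (cong (total (λ y → #paths K (suc h) y m)) (filter-down K)))
      (cong₂ _+_ (#paths-low ≤-refl down m)
        (cong₂ _+_ (#paths-low ≤-refl flatE m) (cong (_+ 0) (#paths-low ≤-refl flatD m))))

  #free-K : ∀ m → #free K K (suc m) ≡ #paths K K down m + (#paths K K flatE m + (#paths K K flatE m + 0))
  #free-K m =
    cong₂ _+_ (#paths-above K m)
      (cong (λ c → #paths K K down m + (#paths K K flatE m + (c + 0))) (#paths-K-flatD m))

  -- Write t, b, e for the completions from K, after `down` and after `flatE`. Then t(m+1) = b(m) +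
  -- 2e(m) and e(m+1) = b(m) + e(m), and e is eliminated.
  #free-K-suc : ∀ m → #free K K (suc (suc m)) ≡ #free K K (suc m) + #paths K K down (suc m) + #paths K K down m
  #free-K-suc m = begin
    #free K K (suc (suc m))        ≡⟨ #free-K (suc m) ⟩
    d′ + (e′ + (e′ + 0))           ≡⟨ cong (λ c → d′ + (c + (c + 0))) (#paths-K-flatE m) ⟩
    d′ + (d + (e + 0) + (d + (e + 0) + 0)) ≡⟨ lemma d d′ e ⟩
    d + (e + (e + 0)) + d′ + d     ≡⟨ cong (λ c → c + d′ + d) (#free-K m) ⟨
    #free K K (suc m) + d′ + d     ∎
    where
    open ≡-Reasoning
    d = #paths K K down m
    d′ = #paths K K down (suc m)
    e = #paths K K flatE m
    e′ = #paths K K flatE (suc m)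
    lemma : ∀ d d′ e → d′ + (d + (e + 0) + (d + (e + 0) + 0)) ≡ d + (e + (e + 0)) + d′ + d
    lemma = NatSolver.solve-∀

#free-zero : ∀ {K} → 0 < K → ∀ m → #free K 0 (suc m) ≡ #free K 1 m + (#free K 0 m + 0)
#free-zero 0<K m = cong₂ _+_ (#paths-low 0<K up m) (cong (_+ 0) (#paths-low 0<K flatE m))

#free-mid : ∀ {K h} → suc h < K → ∀ m →
  #free K (suc h) (suc m) ≡ #free K (suc (suc h)) m + (#free K h m + (#free K (suc h) m + (#free K (suc h) m + 0)))
#free-mid h<K m =
  cong₂ _+_ (#paths-low h<K up m) (cong₂ _+_ (#paths-low h<K down m)
    (cong₂ _+_ (#paths-low h<K flatE m) (cong (_+ 0) (#paths-low h<K flatD m))))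

-- The Chebyshev recurrence

sumTo-head : ∀ s (g : ℕ → ℤ) → sumTo (suc s) g ≡ g 0 ℤ.+ sumTo s (λ j → g (suc j))
sumTo-head zero g = refl
sumTo-head (suc s) g = trans (cong (ℤ._+ g (suc (suc s))) (sumTo-head s g)) (ℤₚ.+-assoc (g 0) _ _)

sumTo-cong : ∀ s {g g′ : ℕ → ℤ} → (∀ j → j ≤ s → g j ≡ g′ j) → sumTo s g ≡ sumTo s g′
sumTo-cong zero eq = eq 0 z≤n
sumTo-cong (suc s) eq = cong₂ ℤ._+_ (sumTo-cong s (λ j j≤s → eq j (m≤n⇒m≤1+n j≤s))) (eq (suc s) ≤-refl)

sumTo-minus : ∀ s (g g′ : ℕ → ℤ) → sumTo s (λ j → g j ℤ.- g′ j) ≡ sumTo s g ℤ.- sumTo s g′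
sumTo-minus zero g g′ = refl
sumTo-minus (suc s) g g′ =
  trans (cong (ℤ._+ (g (suc s) ℤ.- g′ (suc s))) (sumTo-minus s g g′))
    (rearrange (sumTo s g) (sumTo s g′) (g (suc s)) (g′ (suc s)))
  where
  rearrange : ∀ a b c d → a ℤ.- b ℤ.+ (c ℤ.- d) ≡ a ℤ.+ c ℤ.- (b ℤ.+ d)
  rearrange = IntSolver.solve-∀

-- Pascal's rule turns L into the Chebyshev recurrence.
L-step : ∀ k n s → L k n (suc (suc s)) ≡ L k n (suc s) ℤ.- L k (n ∸ 1) s
L-step k n s = begin
  sumTo (suc s) (t (suc (suc s)) n) ℤ.+ t (suc (suc s)) n (suc (suc s))
    ≡⟨ cong₂ ℤ._+_ (sumTo-head s (t (suc (suc s)) n)) last≡0 ⟩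
  t (suc (suc s)) n 0 ℤ.+ sumTo s (λ j → t (suc (suc s)) n (suc j)) ℤ.+ + 0
    ≡⟨ ℤₚ.+-identityʳ _ ⟩
  t (suc s) n 0 ℤ.+ sumTo s (λ j → t (suc (suc s)) n (suc j))
    ≡⟨ cong (λ c → t (suc s) n 0 ℤ.+ c) (sumTo-cong s pascal) ⟩
  t (suc s) n 0 ℤ.+ sumTo s (λ j → t (suc s) n (suc j) ℤ.- t s (n ∸ 1) j)
    ≡⟨ cong (λ c → t (suc s) n 0 ℤ.+ c) (sumTo-minus s (λ j → t (suc s) n (suc j)) (t s (n ∸ 1))) ⟩
  t (suc s) n 0 ℤ.+ (sumTo s (λ j → t (suc s) n (suc j)) ℤ.- sumTo s (t s (n ∸ 1)))
    ≡⟨ ℤₚ.+-assoc (t (suc s) n 0) _ _ ⟨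
  t (suc s) n 0 ℤ.+ sumTo s (λ j → t (suc s) n (suc j)) ℤ.- sumTo s (t s (n ∸ 1))
    ≡⟨ cong (ℤ._- sumTo s (t s (n ∸ 1))) (sumTo-head s (t (suc s) n)) ⟨
  L k n (suc s) ℤ.- L k (n ∸ 1) s ∎
  where
  open ≡-Reasoning
  t : ℕ → ℕ → ℕ → ℤ
  t s n j = sign j ℤ.* (+ ((s ∸ j) C j)) ℤ.* (+ f k (n ∸ j))
  last≡0 : t (suc (suc s)) n (suc (suc s)) ≡ + 0
  last≡0 = begin
    sign (suc (suc s)) ℤ.* (+ ((s ∸ s) C suc (suc s))) ℤ.* x
      ≡⟨ cong (λ c → sign (suc (suc s)) ℤ.* (+ (c C suc (suc s))) ℤ.* x) (n∸n≡0 s) ⟩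
    sign (suc (suc s)) ℤ.* (+ (0 C suc (suc s))) ℤ.* x
      ≡⟨ cong (λ c → sign (suc (suc s)) ℤ.* (+ c) ℤ.* x) (k>n⇒nCk≡0 {0} {suc (suc s)} (s≤s z≤n)) ⟩
    sign (suc (suc s)) ℤ.* + 0 ℤ.* x
      ≡⟨ cong (ℤ._* x) (ℤₚ.*-zeroʳ (sign (suc (suc s)))) ⟩
    + 0 ℤ.* x
      ≡⟨ ℤₚ.*-zeroˡ x ⟩
    + 0 ∎
    where x = + f k (n ∸ suc (suc s))
  distribute : ∀ σ a b x → ℤ.- σ ℤ.* (a ℤ.+ b) ℤ.* x ≡ ℤ.- σ ℤ.* b ℤ.* x ℤ.- σ ℤ.* a ℤ.* x
  distribute = IntSolver.solve-∀
  pascal : ∀ j → j ≤ s → t (suc (suc s)) n (suc j) ≡ t (suc s) n (suc j) ℤ.- t s (n ∸ 1) j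
  pascal j j≤s = begin
    sign (suc j) ℤ.* (+ ((suc s ∸ j) C suc j)) ℤ.* (+ f k (n ∸ suc j))
      ≡⟨ cong (λ c → sign (suc j) ℤ.* (+ (c C suc j)) ℤ.* (+ f k (n ∸ suc j))) (+-∸-assoc 1 j≤s) ⟩
    sign (suc j) ℤ.* (+ (suc (s ∸ j) C suc j)) ℤ.* (+ f k (n ∸ suc j))
      ≡⟨ cong (λ c → sign (suc j) ℤ.* (+ c) ℤ.* (+ f k (n ∸ suc j))) (nCk+nC[k+1]≡[n+1]C[k+1] (s ∸ j) j) ⟨
    sign (suc j) ℤ.* ((+ ((s ∸ j) C j)) ℤ.+ (+ ((s ∸ j) C suc j))) ℤ.* (+ f k (n ∸ suc j))
      ≡⟨ distribute (sign j) (+ ((s ∸ j) C j)) (+ ((s ∸ j) C suc j)) (+ f k (n ∸ suc j)) ⟩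
    t (suc s) n (suc j) ℤ.- sign j ℤ.* (+ ((s ∸ j) C j)) ℤ.* (+ f k (n ∸ suc j))
      ≡⟨ cong (λ i → t (suc s) n (suc j) ℤ.- sign j ℤ.* (+ ((s ∸ j) C j)) ℤ.* (+ f k i)) (∸-+-assoc n 1 j) ⟨
    t (suc s) n (suc j) ℤ.- t s (n ∸ 1) j ∎

L-zero : ∀ k n → L k n 0 ≡ + f k n
L-zero k n = ℤₚ.*-identityˡ (+ f k n)

L-one : ∀ k n → L k n 1 ≡ + f k n
L-one k n = trans (cong₂ ℤ._+_ (L-zero k n) refl) (ℤₚ.+-identityʳ _)

-- Completions from a height correspond to even second arguments of `L`; this form reduces the odd
-- ones to them.
L-odd : ∀ k n s → L k n (suc s) ≡ L k n (suc (suc s)) ℤ.+ L k (n ∸ 1) s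
L-odd k n s = trans (rearrange (L k n (suc s)) (L k (n ∸ 1) s)) (cong (ℤ._+ L k (n ∸ 1) s) (sym (L-step k n s)))
  where
  rearrange : ∀ a b → a ≡ a ℤ.- b ℤ.+ b
  rearrange = IntSolver.solve-∀

-- With the odd index eliminated, this is the recurrence that removing the first step gives for
-- completions from three consecutive heights.
L-two-steps : ∀ k n s → L k (suc (suc n)) (4 + s) ≡
  L k (suc (suc n)) (2 + s) ℤ.- L k (suc n) (2 + s) ℤ.- L k (suc n) (2 + s) ℤ.- L k n s
L-two-steps k n s = begin
  L k (2 + n) (4 + s)
    ≡⟨ L-step k (2 + n) (2 + s) ⟩
  L k (2 + n) (3 + s) ℤ.- L k (1 + n) (2 + s)
    ≡⟨ cong (ℤ._- L k (1 + n) (2 + s)) (L-step k (2 + n) (1 + s)) ⟩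
  L k (2 + n) (2 + s) ℤ.- L k (1 + n) (1 + s) ℤ.- L k (1 + n) (2 + s)
    ≡⟨ cong (λ c → L k (2 + n) (2 + s) ℤ.- c ℤ.- L k (1 + n) (2 + s)) (L-odd k (1 + n) s) ⟩
  L k (2 + n) (2 + s) ℤ.- (L k (1 + n) (2 + s) ℤ.+ L k n s) ℤ.- L k (1 + n) (2 + s)
    ≡⟨ rearrange (L k (2 + n) (2 + s)) (L k (1 + n) (2 + s)) (L k n s) ⟩
  L k (2 + n) (2 + s) ℤ.- L k (1 + n) (2 + s) ℤ.- L k (1 + n) (2 + s) ℤ.- L k n s ∎
  where
  open ≡-Reasoning
  rearrange : ∀ a b c → a ℤ.- (b ℤ.+ c) ℤ.- b ≡ a ℤ.- b ℤ.- b ℤ.- c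
  rearrange = IntSolver.solve-∀

-- Completion counts as values of `L`

module _ (k K : ℕ) (0<K : 0 < K) (f-free : ∀ n → f k n ≡ #free K 0 n) where

  open ≡-Reasoning

  -- The first-step decomposition at height h + 1 < K is solved for the count at height h + 2. Terms
  -- with j > h have coefficient (2h - j choose j) = 0, so the truncated subtraction in `L` does no
  -- harm at n = h + m.
  L-free : ∀ h → h ≤ K → ∀ m → L k (h + m) (h * 2) ≡ + #free K h m
  L-free zero _ m = trans (L-zero k m) (cong +_ (f-free m))
  L-free (suc zero) _ m = begin
    L k (suc m) 2                         ≡⟨ L-step k (suc m) 0 ⟩
    L k (suc m) 1 ℤ.- L k m 0             ≡⟨ cong₂ ℤ._-_ (L-one k (suc m)) (L-zero k m) ⟩
    + f k (suc m) ℤ.- + f k m             ≡⟨ cong₂ (λ a b → + a ℤ.- + b) (trans (f-free (suc m)) (#free-zero 0<K m)) (f-free m) ⟩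
    + (#free K 1 m + (#free K 0 m + 0)) ℤ.- + #free K 0 m ≡⟨ cong (λ c → + (#free K 1 m + c) ℤ.- + #free K 0 m) (+-identityʳ _) ⟩
    + #free K 1 m ℤ.+ + #free K 0 m ℤ.- + #free K 0 m ≡⟨ rearrange (+ #free K 1 m) (+ #free K 0 m) ⟩
    + #free K 1 m ∎
    where
    rearrange : ∀ a b → a ℤ.+ b ℤ.- b ≡ a
    rearrange = IntSolver.solve-∀
  L-free (suc (suc h)) h<K m = begin
    L k (2 + (h + m)) (4 + h * 2)
      ≡⟨ L-two-steps k (h + m) (h * 2) ⟩
    L k (2 + (h + m)) (2 + h * 2) ℤ.- L k (1 + (h + m)) (2 + h * 2) ℤ.- L k (1 + (h + m)) (2 + h * 2) ℤ.- L k (h + m) (h * 2)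
      ≡⟨ cong₂ ℤ._-_ (cong₂ ℤ._-_ (cong₂ ℤ._-_
           (trans (cong (λ i → L k (suc i) (2 + h * 2)) (sym (+-suc h m))) (L-free (suc h) (<⇒≤ h<K) (suc m)))
           (L-free (suc h) (<⇒≤ h<K) m)) (L-free (suc h) (<⇒≤ h<K) m))
           (L-free h (<⇒≤ (<⇒≤ h<K)) m) ⟩
    + #free K (suc h) (suc m) ℤ.- + #free K (suc h) m ℤ.- + #free K (suc h) m ℤ.- + #free K h m
      ≡⟨ cong (λ c → + c ℤ.- + #free K (suc h) m ℤ.- + #free K (suc h) m ℤ.- + #free K h m)
           (trans (#free-mid h<K m) (flat (#free K (2 + h) m) (#free K (suc h) m) (#free K h m))) ⟩
    + #free K (2 + h) m ℤ.+ + #free K h m ℤ.+ + #free K (suc h) m ℤ.+ + #free K (suc h) m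
      ℤ.- + #free K (suc h) m ℤ.- + #free K (suc h) m ℤ.- + #free K h m
      ≡⟨ rearrange (+ #free K (2 + h) m) (+ #free K (suc h) m) (+ #free K h m) ⟩
    + #free K (2 + h) m ∎
    where
    flat : ∀ a b c → a + (c + (b + (b + 0))) ≡ a + c + b + b
    flat = NatSolver.solve-∀
    rearrange : ∀ a b c → a ℤ.+ c ℤ.+ b ℤ.+ b ℤ.- b ℤ.- b ℤ.- c ≡ a
    rearrange = IntSolver.solve-∀

-- Here `L k n (2K)` counts completions from height K by n - K steps. The recurrence for these
-- reaches back two steps and unfolding the count after `down` takes a third, so n = K + 3 + m = 5 +
-- h + m.
recurrence-shifted : ∀ h m → (let k = 3 + h; n = 5 + (h + m)) → (∀ n → f k n ≡ #free (2 + h) 0 n) →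
  L k n ((2 + h) * 2) ≡
    L k (n ∸ 1) ((2 + h) * 2) ℤ.+ L k (n ∸ 3) (suc (h * 2)) ℤ.+ L k (n ∸ 3) (suc h * 2)
      ℤ.+ L k (n ∸ 4) (suc (h * 2)) ℤ.+ L k (n ∸ 4) (suc h * 2)
recurrence-shifted h m f-free = begin
  L k (5 + (h + m)) (K * 2)
    ≡⟨ top (3 + m) (trans (cong (λ i → 2 + i) (+-comm h (3 + m))) (cong (λ i → 5 + i) (+-comm m h))) ⟩
  + #free K K (3 + m)
    ≡⟨ cong +_ (#free-K-suc h (suc m)) ⟩
  + #free K K (2 + m) ℤ.+ + #paths K K down (2 + m) ℤ.+ + #paths K K down (1 + m)
    ≡⟨ cong₂ (λ a b → + #free K K (2 + m) ℤ.+ + a ℤ.+ + b) (#paths-K-down h (suc m)) (#paths-K-down h m) ⟩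
  + #free K K (2 + m) ℤ.+ (x₁ ℤ.+ (y₁ ℤ.+ (y₁ ℤ.+ + 0))) ℤ.+ (x₀ ℤ.+ (y₀ ℤ.+ (y₀ ℤ.+ + 0)))
    -- The count x + 2y after a step down is grouped as (y + x) + y: the bracket is the `L` with odd
    -- index, the last y the one with even index.
    ≡⟨ rearrange (+ #free K K (2 + m)) x₁ y₁ x₀ y₀ ⟩
  + #free K K (2 + m) ℤ.+ (y₁ ℤ.+ x₁) ℤ.+ y₁ ℤ.+ (y₀ ℤ.+ x₀) ℤ.+ y₀
    ≡⟨ cong₂ ℤ._+_ (cong₂ ℤ._+_ (cong₂ ℤ._+_ (cong₂ ℤ._+_
         (sym (top (2 + m) (trans (cong (λ i → 2 + i) (+-comm h (2 + m))) (cong (λ i → 4 + i) (+-comm m h)))))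
         (odd (suc m) (+-suc h m))) (even (suc m) (+-suc h m))) (odd m refl)) (even m refl) ⟩
  L k (4 + (h + m)) (K * 2) ℤ.+ L k (2 + (h + m)) (suc (h * 2)) ℤ.+ L k (2 + (h + m)) (suc h * 2)
    ℤ.+ L k (1 + (h + m)) (suc (h * 2)) ℤ.+ L k (1 + (h + m)) (suc h * 2) ∎
  where
  open ≡-Reasoning
  k = 3 + h
  K = 2 + h
  x₀ = + #free K h m
  y₀ = + #free K (suc h) m
  x₁ = + #free K h (suc m)
  y₁ = + #free K (suc h) (suc m)
  rearrange : ∀ t x₁ y₁ x₀ y₀ →
    t ℤ.+ (x₁ ℤ.+ (y₁ ℤ.+ (y₁ ℤ.+ + 0))) ℤ.+ (x₀ ℤ.+ (y₀ ℤ.+ (y₀ ℤ.+ + 0)))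
      ≡ t ℤ.+ (y₁ ℤ.+ x₁) ℤ.+ y₁ ℤ.+ (y₀ ℤ.+ x₀) ℤ.+ y₀
  rearrange = IntSolver.solve-∀
  top : ∀ p {i} → K + p ≡ i → L k i (K * 2) ≡ + #free K K p
  top p refl = L-free k K (s≤s z≤n) f-free K ≤-refl p
  even : ∀ p {i} → h + p ≡ i → + #free K (suc h) p ≡ L k (1 + i) (suc h * 2)
  even p refl = sym (L-free k K (s≤s z≤n) f-free (suc h) (n≤1+n _) p)
  odd : ∀ p {i} → h + p ≡ i → + #free K (suc h) p ℤ.+ + #free K h p ≡ L k (1 + i) (suc (h * 2))
  odd p refl = trans
    (cong₂ ℤ._+_ (even p refl) (sym (L-free k K (s≤s z≤n) f-free h (≤-trans (n≤1+n _) (n≤1+n _)) p)))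
    (sym (L-odd k (suc h + p) (h * 2)))

private
  double : ∀ h → 2 * (3 + h) ≡ 6 + h * 2
  double = NatSolver.solve-∀

  5+h≤2k : ∀ h → 5 + h ≤ 2 * (3 + h)
  5+h≤2k h = subst (5 + h ≤_) (sym (double h)) (+-mono-≤ {5} {6} (n≤1+n 5) (m≤m*n h 2))

recurrence : ∀ k → 3 ≤ k → (∀ n → f k n ≡ #free (k ∸ 1) 0 n) → ∀ n → 2 * k ≤ n →
  L k n (2 * k ∸ 2) ≡
    L k (n ∸ 1) (2 * k ∸ 2) ℤ.+ L k (n ∸ 3) (2 * k ∸ 5) ℤ.+ L k (n ∸ 3) (2 * k ∸ 4)
      ℤ.+ L k (n ∸ 4) (2 * k ∸ 5) ℤ.+ L k (n ∸ 4) (2 * k ∸ 4)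
recurrence (suc (suc (suc h))) (s≤s (s≤s (s≤s z≤n))) f-free n 2k≤n
  with m ← n ∸ (5 + h) | refl ← sym (m+[n∸m]≡n (≤-trans (5+h≤2k h) 2k≤n)) =
  subst (λ d → L k n′ (d ∸ 2) ≡
      L k (n′ ∸ 1) (d ∸ 2) ℤ.+ L k (n′ ∸ 3) (d ∸ 5) ℤ.+ L k (n′ ∸ 3) (d ∸ 4)
        ℤ.+ L k (n′ ∸ 4) (d ∸ 5) ℤ.+ L k (n′ ∸ 4) (d ∸ 4))
    (sym (double h)) (recurrence-shifted h m f-free)
  where
  k = 3 + h
  n′ = 5 + h + m

-- Enumeration of paths and of permutations

module _ {A : Set} where

  ∈-extend⁺ : (P : A → List (List A)) {y : A} {w : List A} {ys : List A} → y ∈ ys → w ∈ P y →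
    y ∷ w ∈ concatMap (λ y → map (y ∷_) (P y)) ys
  ∈-extend⁺ P (here refl) w∈ = ∈-++⁺ˡ (∈-map⁺ _ w∈)
  ∈-extend⁺ P (there y∈) w∈ = ∈-++⁺ʳ _ (∈-extend⁺ P y∈ w∈)

  ∈-extend⁻ : (P : A → List (List A)) {v : List A} (ys : List A) →
    v ∈ concatMap (λ y → map (y ∷_) (P y)) ys → ∃₂ λ y w → v ≡ y ∷ w × y ∈ ys × w ∈ P y
  ∈-extend⁻ P (y ∷ ys) v∈ with ∈-++⁻ (map (y ∷_) (P y)) v∈
  ... | inj₁ v∈ˡ with w , w∈ , eq ← ∈-map⁻ (y ∷_) v∈ˡ = y , w , eq , here refl , w∈
  ... | inj₂ v∈ʳ with z , w , eq , z∈ , w∈ ← ∈-extend⁻ P ys v∈ʳ = z , w , eq , there z∈ , w∈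

  extend-unique : (P : A → List (List A)) {ys : List A} → Unique ys → (∀ y → Unique (P y)) →
    Unique (concatMap (λ y → map (y ∷_) (P y)) ys)
  extend-unique P [] P! = []
  extend-unique P {y ∷ ys} (y∉ ∷ ys!) P! =
    Uniqueₚ.++⁺ (Uniqueₚ.map⁺ (λ { refl → refl }) (P! y)) (extend-unique P ys! P!) disjoint
    where
    disjoint : ∀ {v} → v ∈ map (y ∷_) (P y) × v ∈ concatMap (λ y → map (y ∷_) (P y)) ys → ⊥
    disjoint (v∈ˡ , v∈ʳ) with ∈-map⁻ (y ∷_) v∈ˡ | ∈-extend⁻ P ys v∈ʳ
    ... | w , _ , refl | z , _ , refl , z∈ , _ = All.lookup y∉ z∈ refl

  unique∧set⇒length : {xs ys : List A} → Unique xs → Unique ys →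
    (∀ {v} → v ∈ xs → v ∈ ys) → (∀ {v} → v ∈ ys → v ∈ xs) → length xs ≡ length ys
  unique∧set⇒length xs! ys! to from = ↭-length (∼bag⇒↭ (unique∧set⇒bag xs! ys! (mk⇔ to from)))

  -- Pigeonhole: each x is cancelled against one of its occurrences in ys, and equal lengths leave
  -- nothing over.
  unique∧subset⇒↭ : {xs ys : List A} → Unique xs → (∀ {v} → v ∈ xs → v ∈ ys) → length xs ≡ length ys → xs ↭ ys
  unique∧subset⇒↭ {[]} {[]} [] _ _ = ↭-refl
  unique∧subset⇒↭ {x ∷ xs} {ys} (x∉ ∷ xs!) inc eq with us , vs , refl ← ∈-∃++ (inc (here refl)) =
    ↭-trans (prep x (unique∧subset⇒↭ xs! sub (suc-injective (trans eq (↭-length (shift x us vs))))))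
      (↭-sym (shift x us vs))
    where
    sub : ∀ {v} → v ∈ xs → v ∈ us ++ vs
    sub v∈ with ∈-resp-↭ (shift x us vs) (inc (there v∈))
    ... | here refl = ⊥-elim (All.lookup x∉ v∈ refl)
    ... | there v∈′ = v∈′

-- The members of `paths` as an inductive predicate. The index carries the previous step and its
-- starting height because `Bad` compares neighbouring steps.
data Path (K : ℕ) (g : ℕ) (x : Step) : List Step → Set where
  end : move g x ≡ 0 → Path K g x []
  step : ∀ {y π} → (move g x ≡ 0 → posE y ≡ true) → ¬ Bad K g x y → Path K (move g x) y π → Path K g x (y ∷ π)

∈-starts⁺ : ∀ h y → (h ≡ 0 → posE y ≡ true) → y ∈ starts h
∈-starts⁺ zero up _ = here refl
∈-starts⁺ zero down e with () ← e refl
∈-starts⁺ zero flatE _ = there (here refl)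
∈-starts⁺ zero flatD e with () ← e refl
∈-starts⁺ (suc h) up _ = here refl
∈-starts⁺ (suc h) down _ = there (here refl)
∈-starts⁺ (suc h) flatE _ = there (there (here refl))
∈-starts⁺ (suc h) flatD _ = there (there (there (here refl)))

∈-starts⁻ : ∀ h {y} → y ∈ starts h → h ≡ 0 → posE y ≡ true
∈-starts⁻ zero (here refl) _ = refl
∈-starts⁻ zero (there (here refl)) _ = refl

starts-unique : ∀ h → Unique (starts h)
starts-unique zero = ((λ ()) ∷ []) ∷ [] ∷ []
starts-unique (suc h) = ((λ ()) ∷ (λ ()) ∷ (λ ()) ∷ []) ∷ ((λ ()) ∷ (λ ()) ∷ []) ∷ ((λ ()) ∷ []) ∷ [] ∷ []

module _ {K : ℕ} where

  ∈-paths⁺ : ∀ {g x π} → Path K g x π → π ∈ paths K g x (length π)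
  ∈-paths⁺ {g} {x} (end eq) with move g x
  ... | zero = here refl
  ∈-paths⁺ {g} {x} (step {y} {π} allowed ¬bad p) =
    ∈-extend⁺ (λ y → paths K (move g x) y (length π))
      (∈-filter⁺ (¬? ∘ bad? K g x) (∈-starts⁺ (move g x) y allowed) ¬bad) (∈-paths⁺ p)

  ∈-paths⁻ : ∀ g x m {π} → π ∈ paths K g x m → Path K g x π × length π ≡ m
  ∈-paths⁻ g x zero π∈ with move g x in eq
  ∈-paths⁻ g x zero (here refl) | zero = end eq , refl
  ∈-paths⁻ g x (suc m) π∈
    with y , π′ , refl , y∈ , π′∈ ← ∈-extend⁻ (λ y → paths K (move g x) y m) (filter (¬? ∘ bad? K g x) (starts (move g x))) π∈
    with y∈′ , ¬bad ← ∈-filter⁻ (¬? ∘ bad? K g x) {xs = starts (move g x)} y∈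
    with p , len ← ∈-paths⁻ (move g x) y m π′∈ =
    step (∈-starts⁻ (move g x) y∈′) ¬bad p , cong suc len

  paths-unique : ∀ g x m → Unique (paths K g x m)
  paths-unique g x zero with move g x
  ... | zero = [] ∷ []
  ... | suc _ = []
  paths-unique g x (suc m) =
    extend-unique (λ y → paths K (move g x) y m)
      (Uniqueₚ.filter⁺ (¬? ∘ bad? K g x) (starts-unique (move g x))) (λ y → paths-unique (move g x) y m)

interval : ℕ → ℕ → List ℕ
interval a zero = []
interval a (suc m) = a ∷ interval (suc a) m

range≡interval : ∀ a b → range a b ≡ interval a (suc b ∸ a)
range≡interval a b = go (λ i → i) a (suc b ∸ a) (λ i → refl)
  where
  go : ∀ (g : ℕ → ℕ) c m → (∀ i → a + g i ≡ c + i) → map (λ i → a + i) (applyUpTo g m) ≡ interval c m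
  go g c zero eq = refl
  go g c (suc m) eq =
    cong₂ _∷_ (trans (eq 0) (+-identityʳ c)) (go (g ∘ suc) (suc c) m (λ i → trans (eq (suc i)) (+-suc c i)))

interval-++ : ∀ a m n → interval a (m + n) ≡ interval a m ++ interval (m + a) n
interval-++ a zero n = refl
interval-++ a (suc m) n = cong (a ∷_) (trans (interval-++ (suc a) m n) (cong (λ c → interval (suc a) m ++ interval c n) (+-suc m a)))

length-interval : ∀ a m → length (interval a m) ≡ m
length-interval a zero = refl
length-interval a (suc m) = cong suc (length-interval (suc a) m)

interval-≥ : ∀ a m → All (a ≤_) (interval a m)
interval-≥ a zero = []
interval-≥ a (suc m) = ≤-refl ∷ All.map (≤-trans (n≤1+n a)) (interval-≥ (suc a) m)

interval-sorted : ∀ a m → AllPairs _<_ (interval a m)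
interval-sorted a zero = []
interval-sorted a (suc m) = interval-≥ (suc a) m ∷ interval-sorted (suc a) m

sorted⇒unique : ∀ {xs} → AllPairs _<_ xs → Unique xs
sorted⇒unique = AllPairs.map <⇒≢

-- Boolean tests and the list `perms`

T-all⁻ : {A : Set} (p : A → Bool) (xs : List A) → T (allB p xs) → All (T ∘ p) xs
T-all⁻ p [] _ = []
T-all⁻ p (x ∷ xs) t with px , pxs ← Equivalence.to T-∧ t = px ∷ T-all⁻ p xs pxs

T-all⁺ : {A : Set} (p : A → Bool) {xs : List A} → All (T ∘ p) xs → T (allB p xs)
T-all⁺ p [] = tt
T-all⁺ p (px ∷ pxs) = Equivalence.from T-∧ (px , T-all⁺ p pxs)

T-not⁺ : ∀ b → ¬ T b → T (not b)
T-not⁺ true ¬t = ¬t tt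
T-not⁺ false ¬t = tt

T-not⁻ : ∀ b → T (not b) → ¬ T b
T-not⁻ false _ ()

distinct⁻ : ∀ w → T (distinctᵇ w) → Unique w
distinct⁻ [] _ = []
distinct⁻ (x ∷ w) t with x∉ , w! ← Equivalence.to T-∧ t =
  All.map (λ {y} ¬e e → T-not⁻ (x ≡ᵇ y) ¬e (≡⇒≡ᵇ x y e)) (T-all⁻ (λ y → not (x ≡ᵇ y)) w x∉) ∷ distinct⁻ w w!

distinct⁺ : ∀ {w} → Unique w → T (distinctᵇ w)
distinct⁺ [] = tt
distinct⁺ {x ∷ w} (x∉ ∷ w!) =
  Equivalence.from T-∧ (T-all⁺ (λ y → not (x ≡ᵇ y)) (All.map (λ {y} ne → T-not⁺ (x ≡ᵇ y) (ne ∘ ≡ᵇ⇒≡ x y)) x∉) , distinct⁺ w!)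

∈-words⁺ : ∀ {A} w → All (_∈ A) w → w ∈ words (length w) A
∈-words⁺ [] [] = here refl
∈-words⁺ (x ∷ w) (x∈ ∷ w∈) = ∈-extend⁺ (λ _ → words (length w) _) x∈ (∈-words⁺ w w∈)

∈-words⁻ : ∀ m A {w} → w ∈ words m A → length w ≡ m × All (_∈ A) w
∈-words⁻ zero A (here refl) = refl , []
∈-words⁻ (suc m) A w∈ with y , v , refl , y∈ , v∈ ← ∈-extend⁻ (λ _ → words m A) A w∈
  with len , all ← ∈-words⁻ m A v∈ = cong suc len , y∈ ∷ all

words-unique : ∀ m {A} → Unique A → Unique (words m A)
words-unique zero A! = [] ∷ []
words-unique (suc m) A! = extend-unique (λ _ → words m _) A! (λ _ → words-unique m A!)

range-1 : ∀ n → range 1 n ≡ interval 1 n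
range-1 n = range≡interval 1 n

perms-unique : ∀ n → Unique (perms n)
perms-unique n = Uniqueₚ.filter⁺ (λ w → T? (distinctᵇ w))
  (words-unique n (subst Unique (sym (range-1 n)) (sorted⇒unique (interval-sorted 1 n))))

∈-perms⁻ : ∀ n {w} → w ∈ perms n → w ↭ interval 1 n
∈-perms⁻ n {w} w∈
  with w∈′ , t ← ∈-filter⁻ (λ w → T? (distinctᵇ w)) {xs = words n (range 1 n)} w∈
  with len , all ← ∈-words⁻ n (range 1 n) w∈′ =
  unique∧subset⇒↭ (distinct⁻ w t) (λ v∈ → subst (_ ∈_) (range-1 n) (All.lookup all v∈))
    (trans len (sym (length-interval 1 n)))

↭-interval⇒unique : ∀ {w} a n → w ↭ interval a n → Unique w
↭-interval⇒unique a n w↭ = Permₛ.Unique-resp-↭ (setoid ℕ) (↭⇒↭ₛ (↭-sym w↭)) (sorted⇒unique (interval-sorted a n))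

∈-perms⁺ : ∀ n {w} → w ↭ interval 1 n → w ∈ perms n
∈-perms⁺ n {w} w↭ =
  ∈-filter⁺ (λ w → T? (distinctᵇ w))
    (subst (λ m → w ∈ words m (range 1 n)) (trans (↭-length w↭) (length-interval 1 n))
      (∈-words⁺ w (All.tabulate λ v∈ → subst (_ ∈_) (sym (range-1 n)) (∈-resp-↭ w↭ v∈))))
    (distinct⁺ (↭-interval⇒unique 1 n w↭))

-- The permutation of a path

count : Bool → List Bool → ℕ
count b [] = 0
count true (true ∷ bs) = suc (count true bs)
count true (false ∷ bs) = count true bs
count false (true ∷ bs) = count false bs
count false (false ∷ bs) = suc (count false bs)

places : Bool → ℕ → List Bool → List ℕ
places b i [] = []
places true i (true ∷ bs) = i ∷ places true (suc i) bs
places true i (false ∷ bs) = places true (suc i) bs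
places false i (true ∷ bs) = places false (suc i) bs
places false i (false ∷ bs) = i ∷ places false (suc i) bs

length-places : ∀ b i bs → length (places b i bs) ≡ count b bs
length-places true i [] = refl
length-places false i [] = refl
length-places true i (true ∷ bs) = cong suc (length-places true (suc i) bs)
length-places true i (false ∷ bs) = length-places true (suc i) bs
length-places false i (true ∷ bs) = length-places false (suc i) bs
length-places false i (false ∷ bs) = cong suc (length-places false (suc i) bs)

places-≥ : ∀ b i bs → All (i ≤_) (places b i bs)
places-≥ true i [] = []
places-≥ false i [] = []
places-≥ true i (true ∷ bs) = ≤-refl ∷ All.map <⇒≤ (places-≥ true (suc i) bs)
places-≥ true i (false ∷ bs) = All.map <⇒≤ (places-≥ true (suc i) bs)
places-≥ false i (true ∷ bs) = All.map <⇒≤ (places-≥ false (suc i) bs)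
places-≥ false i (false ∷ bs) = ≤-refl ∷ All.map <⇒≤ (places-≥ false (suc i) bs)

places-sorted : ∀ b i bs → AllPairs _<_ (places b i bs)
places-sorted true i [] = []
places-sorted false i [] = []
places-sorted true i (true ∷ bs) = places-≥ true (suc i) bs ∷ places-sorted true (suc i) bs
places-sorted true i (false ∷ bs) = places-sorted true (suc i) bs
places-sorted false i (true ∷ bs) = places-sorted false (suc i) bs
places-sorted false i (false ∷ bs) = places-≥ false (suc i) bs ∷ places-sorted false (suc i) bs

places-↭ : ∀ i bs → places true i bs ++ places false i bs ↭ interval i (length bs)
places-↭ i [] = ↭-refl
places-↭ i (true ∷ bs) = prep i (places-↭ (suc i) bs)
places-↭ i (false ∷ bs) =
  ↭-trans (shift i (places true (suc i) bs) (places false (suc i) bs)) (prep i (places-↭ (suc i) bs))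

places-injective : ∀ i bs cs → length bs ≡ length cs → places true i bs ≡ places true i cs → bs ≡ cs
places-injective i [] [] _ _ = refl
places-injective i (true ∷ bs) (true ∷ cs) len eq =
  cong (true ∷_) (places-injective (suc i) bs cs (suc-injective len) (∷-injectiveʳ eq))
places-injective i (false ∷ bs) (false ∷ cs) len eq =
  cong (false ∷_) (places-injective (suc i) bs cs (suc-injective len) eq)
places-injective i (true ∷ bs) (false ∷ cs) len eq =
  contradiction (All.head (subst (All (suc i ≤_)) (sym eq) (places-≥ true (suc i) cs))) 1+n≰n
places-injective i (false ∷ bs) (true ∷ cs) len eq =
  contradiction (All.head (subst (All (suc i ≤_)) eq (places-≥ true (suc i) bs))) 1+n≰n

labels : List (Bool × ℕ) → List Bool
labels = map proj₁

entries : List (Bool × ℕ) → List ℕ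
entries = map proj₂

entriesOf : Bool → List (Bool × ℕ) → List ℕ
entriesOf b [] = []
entriesOf true ((true , x) ∷ w) = x ∷ entriesOf true w
entriesOf true ((false , x) ∷ w) = entriesOf true w
entriesOf false ((true , x) ∷ w) = entriesOf false w
entriesOf false ((false , x) ∷ w) = x ∷ entriesOf false w

entries-↭ : ∀ w → entries w ↭ entriesOf true w ++ entriesOf false w
entries-↭ [] = ↭-refl
entries-↭ ((true , x) ∷ w) = prep x (entries-↭ w)
entries-↭ ((false , x) ∷ w) =
  ↭-trans (prep x (entries-↭ w)) (↭-sym (shift x (entriesOf true w) (entriesOf false w)))

-- In a labelled word avoiding 321, an inversion starts at a left-to-right maximum and ends at a non-maximum.
Ordered : Bool × ℕ → Bool × ℕ → Set
Ordered (b , x) (c , y) = x < y ⊎ (b ≡ true × c ≡ false)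

-- In a permutation avoiding 321 the left-to-right maxima are the weak excedances. In this form a
-- label depends only on the entry and its position, so the entries determine the labels.
data Excedances : ℕ → List (Bool × ℕ) → Set where
  [] : ∀ {i} → Excedances i []
  exc : ∀ {i x w} → i ≤ x → Excedances (suc i) w → Excedances i ((true , x) ∷ w)
  def : ∀ {i x w} → x < i → Excedances (suc i) w → Excedances i ((false , x) ∷ w)

excedances-injective : ∀ {i w v} → Excedances i w → Excedances i v → entries w ≡ entries v → w ≡ v
excedances-injective [] [] _ = refl
excedances-injective (exc _ ew) (exc _ ev) eq with refl , eq′ ← ∷-injective eq =
  cong (_ ∷_) (excedances-injective ew ev eq′)
excedances-injective (def _ ew) (def _ ev) eq with refl , eq′ ← ∷-injective eq =
  cong (_ ∷_) (excedances-injective ew ev eq′)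
excedances-injective (exc i≤x _) (def x<i _) eq with refl ← ∷-injectiveˡ eq = contradiction x<i (≤⇒≯ i≤x)
excedances-injective (def x<i _) (exc i≤x _) eq with refl ← ∷-injectiveˡ eq = contradiction x<i (≤⇒≯ i≤x)

-- Entries with equal labels are in order by sortedness. A non-maximum is smaller than its position
-- and a later maximum is at least its own position, so these two are in order as well.
excedances⇒ordered : ∀ {i w} → Excedances i w →
  AllPairs _<_ (entriesOf true w) → AllPairs _<_ (entriesOf false w) → AllPairs Ordered w
excedances⇒ordered [] _ _ = []
excedances⇒ordered (exc {x = x} _ ew) (x< ∷ es) ds = after _ x< ∷ excedances⇒ordered ew es ds
  where
  after : ∀ w → All (x <_) (entriesOf true w) → All (Ordered (true , x)) w
  after [] _ = []
  after ((true , y) ∷ w) (x<y ∷ a) = inj₁ x<y ∷ after w a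
  after ((false , y) ∷ w) a = inj₂ (refl , refl) ∷ after w a
excedances⇒ordered (def {x = x} x<i ew) es (x< ∷ ds) = after ew (m≤n⇒m≤1+n x<i) x< ∷ excedances⇒ordered ew es ds
  where
  after : ∀ {i w} → Excedances i w → x < i → All (x <_) (entriesOf false w) → All (Ordered (false , x)) w
  after [] _ _ = []
  after (exc i≤y ew) x<i a = inj₁ (<-≤-trans x<i i≤y) ∷ after ew (m≤n⇒m≤1+n x<i) a
  after (def _ ew) x<i (x<y ∷ a) = inj₁ x<y ∷ after ew (m≤n⇒m≤1+n x<i) a

-- The last clause also catches lists that run out too early; `decode` shows that for a Motzkin path
-- it is met only at the end.
merge : List Bool → List ℕ → List ℕ → List (Bool × ℕ)
merge (true ∷ bs) (e ∷ es) ds = (true , e) ∷ merge bs es ds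
merge (false ∷ bs) es (d ∷ ds) = (false , d) ∷ merge bs es ds
merge _ _ _ = []

-- What is left of `Path` without the restriction by `Bad`; it suffices for decoding a path to an
-- avoider of 321.
data Motzkin : ℕ → List Step → Set where
  end : Motzkin 0 []
  step : ∀ {h y π} → (h ≡ 0 → posE y ≡ true) → Motzkin (move h y) π → Motzkin h (y ∷ π)

path⇒motzkin : ∀ {K g x π} → Path K g x π → Motzkin (move g x) π
path⇒motzkin {g = g} {x} (end eq) rewrite eq = end
path⇒motzkin (step allowed _ p) = step allowed (path⇒motzkin p)

P V : List Step → List Bool
P = map posE
V = map valE

-- Since the path ends at height 0, its height is the surplus of maxima among the remaining values
-- over those among the remaining positions.
motzkin-count : ∀ {h π} → Motzkin h π → h + count true (P π) ≡ count true (V π)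
motzkin-count end = refl
motzkin-count (step {h} {up} _ m) = trans (+-suc h _) (motzkin-count m)
motzkin-count (step {zero} {down} allowed m) with () ← allowed refl
motzkin-count (step {suc h} {down} _ m) = cong suc (motzkin-count m)
motzkin-count (step {h} {flatE} _ m) = trans (+-suc h _) (cong suc (motzkin-count m))
motzkin-count (step {h} {flatD} _ m) = motzkin-count m

record Decoded (i : ℕ) (bs : List Bool) (es ds : List ℕ) (w : List (Bool × ℕ)) : Set where
  field
    labels≡ : labels w ≡ bs
    maxima≡ : entriesOf true w ≡ es
    others≡ : entriesOf false w ≡ ds
    excedances : Excedances i w

decode-exc : ∀ {i e bs es ds w} → i ≤ e → Decoded (suc i) bs es ds w →
  Decoded i (true ∷ bs) (e ∷ es) ds ((true , e) ∷ w)
decode-exc i≤e d = record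
  { labels≡ = cong (true ∷_) labels≡ ; maxima≡ = cong (_ ∷_) maxima≡ ; others≡ = others≡ ; excedances = exc i≤e excedances }
  where open Decoded d

decode-def : ∀ {i e bs es ds w} → e < i → Decoded (suc i) bs es ds w →
  Decoded i (false ∷ bs) es (e ∷ ds) ((false , e) ∷ w)
decode-def e<i d = record
  { labels≡ = cong (false ∷_) labels≡ ; maxima≡ = maxima≡ ; others≡ = cong (_ ∷_) others≡ ; excedances = def e<i excedances }
  where open Decoded d

drop-uncons : ∀ h (xs : List ℕ) {i} → All (i ≤_) xs → h < length xs →
  ∃ λ e → i ≤ e × drop h xs ≡ e ∷ drop (suc h) xs
drop-uncons zero (x ∷ xs) (i≤x ∷ _) _ = x , i≤x , refl
drop-uncons (suc h) (x ∷ xs) (_ ∷ a) (s≤s h<) = drop-uncons h xs a h<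

private
  remaining : ∀ h b c bs → h + suc c ≡ count b bs → ∀ i → h < length (places b i bs)
  remaining h b c bs eq i =
    subst (h <_) (trans (sym (+-suc h c)) (trans eq (sym (length-places b i bs)))) (s≤s (m≤m+n h c))

-- At height h the word has already used the h smallest maxima among the values ≥ i, while
-- h non-maxima Q below i are still waiting for a position.
decode : ∀ {h π} → Motzkin h π → ∀ i Q → length Q ≡ h → All (_< i) Q →
  Decoded i (P π) (drop h (places true i (V π))) (Q ++ places false i (V π))
    (merge (P π) (drop h (places true i (V π))) (Q ++ places false i (V π)))
decode end i [] refl [] = record { labels≡ = refl ; maxima≡ = refl ; others≡ = refl ; excedances = [] }
decode {h} (step {y = up} {π} _ m) i Q len Q<i
  with e , i≤e , eq ← drop-uncons h (places true (suc i) (V π)) (places-≥ true (suc i) (V π))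
                        (remaining h true (count true (P π)) (V π) (trans (+-suc h _) (motzkin-count m)) (suc i))
  rewrite eq | sym (++-assoc Q (i ∷ []) (places false (suc i) (V π))) =
  decode-exc (<⇒≤ i≤e)
    (decode m (suc i) (Q ++ i ∷ []) (trans (length-++ Q) (trans (+-comm (length Q) 1) (cong suc len)))
      (Allₚ.++⁺ (All.map m≤n⇒m≤1+n Q<i) (≤-refl ∷ [])))
decode {zero} (step {y = down} allowed m) with () ← allowed refl
decode {suc h} (step {y = down} _ m) i (q ∷ Q) len (q<i ∷ Q<i) =
  decode-def q<i (decode m (suc i) Q (suc-injective len) (All.map m≤n⇒m≤1+n Q<i))
decode {zero} (step {y = flatE} _ m) i [] len [] = decode-exc ≤-refl (decode m (suc i) [] refl [])
decode {suc h} (step {y = flatE} {π} _ m) i Q len Q<i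
  with e , i≤e , eq ← drop-uncons h (places true (suc i) (V π)) (places-≥ true (suc i) (V π))
                        (remaining h true (count true (P π)) (V π) (trans (+-suc h _) (motzkin-count m)) (suc i))
  rewrite eq =
  decode-exc (<⇒≤ i≤e) (decode m (suc i) Q len (All.map m≤n⇒m≤1+n Q<i))
decode {zero} (step {y = flatD} allowed m) with () ← allowed refl
decode {suc h} (step {y = flatD} {π} _ m) i (q ∷ Q) len (q<i ∷ Q<i)
  rewrite sym (++-assoc Q (i ∷ []) (places false (suc i) (V π))) =
  decode-def q<i
    (decode m (suc i) (Q ++ i ∷ []) (trans (length-++ Q) (trans (+-comm (length Q) 1) len))
      (Allₚ.++⁺ (All.map m≤n⇒m≤1+n Q<i) (≤-refl ∷ [])))

-- The interface shared by both directions of the bijection: it holds for the word decoded from a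
-- path and for a permutation labelled by its left-to-right maxima.
record Codes (w : List (Bool × ℕ)) (π : List Step) : Set where
  field
    codes-labels : labels w ≡ P π
    codes-entries : ∀ b → entriesOf b w ≡ places b 1 (V π)

labelled : List Step → List (Bool × ℕ)
labelled π = merge (P π) (places true 1 (V π)) (places false 1 (V π))

word : List Step → List ℕ
word π = entries (labelled π)

module _ {π : List Step} (m : Motzkin 0 π) where
  private
    module D = Decoded (decode m 1 [] refl [])

  labelled-codes : Codes (labelled π) π
  labelled-codes = record
    { codes-labels = D.labels≡ ; codes-entries = λ { true → D.maxima≡ ; false → D.others≡ } }

  labelled-excedances : Excedances 1 (labelled π)
  labelled-excedances = D.excedances

  labelled-ordered : AllPairs Ordered (labelled π)
  labelled-ordered = excedances⇒ordered D.excedances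
    (subst (AllPairs _<_) (sym D.maxima≡) (places-sorted true 1 (V π)))
    (subst (AllPairs _<_) (sym D.others≡) (places-sorted false 1 (V π)))

codes-↭ : ∀ {w π} → Codes w π → entries w ↭ interval 1 (length π)
codes-↭ {w} {π} c = ↭-trans (entries-↭ w)
  (subst (λ l → entriesOf true w ++ entriesOf false w ↭ interval 1 l) (length-map valE π)
    (subst (_↭ interval 1 (length (V π)))
      (sym (cong₂ _++_ (codes-entries true) (codes-entries false))) (places-↭ 1 (V π))))
  where open Codes c

bits-injective : ∀ π ρ → P π ≡ P ρ → V π ≡ V ρ → π ≡ ρ
bits-injective [] [] _ _ = refl
bits-injective (x ∷ π) (y ∷ ρ) p v =
  cong₂ _∷_ (step-injective x y (∷-injectiveˡ p) (∷-injectiveˡ v)) (bits-injective π ρ (∷-injectiveʳ p) (∷-injectiveʳ v))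
  where
  step-injective : ∀ x y → posE x ≡ posE y → valE x ≡ valE y → x ≡ y
  step-injective up up _ _ = refl
  step-injective down down _ _ = refl
  step-injective flatE flatE _ _ = refl
  step-injective flatD flatD _ _ = refl

codes-injective : ∀ {w π ρ} → Codes w π → Codes w ρ → π ≡ ρ
codes-injective {w} {π} {ρ} c d =
  bits-injective π ρ P≡ (places-injective 1 (V π) (V ρ) len (trans (sym (C.codes-entries true)) (D.codes-entries true)))
  where
  module C = Codes c
  module D = Codes d
  P≡ = trans (sym C.codes-labels) D.codes-labels
  len : length (V π) ≡ length (V ρ)
  len = begin
    length (V π) ≡⟨ length-map valE π ⟩
    length π     ≡⟨ length-map posE π ⟨
    length (P π) ≡⟨ cong length P≡ ⟩
    length (P ρ) ≡⟨ length-map posE ρ ⟩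
    length ρ     ≡⟨ length-map valE ρ ⟨
    length (V ρ) ∎
    where open ≡-Reasoning

-- The entries determine the labels because these mark weak excedances; the labels give the position
-- bits and the values of the maxima give the value bits.
word-injective : ∀ {π ρ} → Motzkin 0 π → Motzkin 0 ρ → word π ≡ word ρ → π ≡ ρ
word-injective {π} {ρ} m n eq =
  codes-injective (labelled-codes m)
    (subst (λ w → Codes w ρ) (sym (excedances-injective (labelled-excedances m) (labelled-excedances n) eq)) (labelled-codes n))

-- Patterns

Contains : List ℕ → List ℕ → Set
Contains w τ = ∃ λ s → s ⊆ w × T (orderIso s τ)

T-any⁺ : {A : Set} (p : A → Bool) {x : A} {xs : List A} → x ∈ xs → T (p x) → T (anyB p xs)
T-any⁺ p (here refl) px = Equivalence.from T-∨ (inj₁ px)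
T-any⁺ p {xs = y ∷ _} (there x∈) px = Equivalence.from (T-∨ {p y}) (inj₂ (T-any⁺ p x∈ px))

T-any⁻ : {A : Set} (p : A → Bool) (xs : List A) → T (anyB p xs) → ∃ λ x → x ∈ xs × T (p x)
T-any⁻ p (x ∷ xs) t with Equivalence.to (T-∨ {p x}) t
... | inj₁ px = x , here refl , px
... | inj₂ pxs with y , y∈ , py ← T-any⁻ p xs pxs = y , there y∈ , py

∈-subseqs⁺ : ∀ {s w} → s ⊆ w → s ∈ subseqs w
∈-subseqs⁺ [] = here refl
∈-subseqs⁺ (x Sublist.∷ʳ s⊆) = ∈-++⁺ʳ (map (x ∷_) _) (∈-subseqs⁺ s⊆)
∈-subseqs⁺ (refl ∷ s⊆) = ∈-++⁺ˡ (∈-map⁺ _ (∈-subseqs⁺ s⊆))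

∈-subseqs⁻ : ∀ {s} w → s ∈ subseqs w → s ⊆ w
∈-subseqs⁻ [] (here refl) = []
∈-subseqs⁻ (x ∷ w) s∈ with ∈-++⁻ (map (x ∷_) (subseqs w)) s∈
... | inj₁ s∈ˡ with v , v∈ , refl ← ∈-map⁻ (x ∷_) s∈ˡ = refl ∷ ∈-subseqs⁻ w v∈
... | inj₂ s∈ʳ = x Sublist.∷ʳ ∈-subseqs⁻ w s∈ʳ

avoids⁺ : ∀ {w τ} → ¬ Contains w τ → T (avoidsᵇ w τ)
avoids⁺ {w} {τ} ¬c = T-not⁺ _ λ t →
  let s , s∈ , iso = T-any⁻ (λ s → orderIso s τ) (subseqs w) t in ¬c (s , ∈-subseqs⁻ w s∈ , iso)

avoids⁻ : ∀ {w τ} → T (avoidsᵇ w τ) → ¬ Contains w τ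
avoids⁻ {w} {τ} t (s , s⊆ , iso) = T-not⁻ _ t (T-any⁺ (λ s → orderIso s τ) (∈-subseqs⁺ s⊆) iso)

SameOrder : ℕ × ℕ → ℕ × ℕ → Set
SameOrder (x , t) (y , u) = (t < u → x < y) × (u < t → y < x)

private
  ⇔ᵇ⁻ : ∀ a b → T (a ⇔ᵇ b) → T b → T a
  ⇔ᵇ⁻ true true _ _ = tt

  ⇔ᵇ⁺ : ∀ a b → (T a → T b) → (T b → T a) → T (a ⇔ᵇ b)
  ⇔ᵇ⁺ true true _ _ = tt
  ⇔ᵇ⁺ true false to _ = to tt
  ⇔ᵇ⁺ false true _ from = from tt
  ⇔ᵇ⁺ false false _ _ = tt

orderIso⁻ : ∀ s τ → T (orderIso s τ) → length s ≡ length τ × AllPairs SameOrder (zip s τ)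
orderIso⁻ [] [] _ = refl , []
orderIso⁻ (x ∷ s) (t ∷ τ) iso
  with compare , iso′ ← Equivalence.to T-∧ iso
  with len , iso″ ← Equivalence.to (T-∧ {length s ≡ᵇ length τ}) iso′ =
  cong suc (≡ᵇ⇒≡ (length s) (length τ) len) ,
  All.map (λ {p} → same {p}) (T-all⁻ _ (zip s τ) compare) ∷ proj₂ (orderIso⁻ s τ iso″)
  where
  same : ∀ {p} → T (((x <ᵇ proj₁ p) ⇔ᵇ (t <ᵇ proj₂ p)) ∧ ((proj₁ p <ᵇ x) ⇔ᵇ (proj₂ p <ᵇ t))) → SameOrder (x , t) p
  same {y , u} c with c₁ , c₂ ← Equivalence.to T-∧ c =
    (λ t<u → <ᵇ⇒< x y (⇔ᵇ⁻ (x <ᵇ y) (t <ᵇ u) c₁ (<⇒<ᵇ t<u))) ,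
    (λ u<t → <ᵇ⇒< y x (⇔ᵇ⁻ (y <ᵇ x) (u <ᵇ t) c₂ (<⇒<ᵇ u<t)))

module _ (g : ℕ → ℕ) (m : ℕ) (mono : ∀ {t u} → t < u → u < m → g t < g u) where

  private
    reflects : ∀ {t u} → t < m → u < m → g t < g u → t < u
    reflects {t} {u} t< u< gt<gu with t <? u
    ... | yes t<u = t<u
    ... | no t≮u with m≤n⇒m<n∨m≡n (≮⇒≥ t≮u)
    ... | inj₁ u<t = contradiction (mono u<t t<) (<-asym gt<gu)
    ... | inj₂ refl = contradiction gt<gu (n≮n _)

    agree : ∀ {t u} → t < m → u < m → T ((g t <ᵇ g u) ⇔ᵇ (t <ᵇ u))
    agree {t} {u} t< u< = ⇔ᵇ⁺ (g t <ᵇ g u) (t <ᵇ u)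
      (λ l → <⇒<ᵇ (reflects t< u< (<ᵇ⇒< _ _ l))) (λ l → <⇒<ᵇ (mono (<ᵇ⇒< _ _ l) u<))

  orderIso-map : ∀ {τ} → All (_< m) τ → T (orderIso (map g τ) τ)
  orderIso-map [] = tt
  orderIso-map {t ∷ τ} (t< ∷ τ<) =
    Equivalence.from T-∧
      (T-all⁺ _ (compare τ<) , Equivalence.from T-∧ (≡⇒≡ᵇ _ _ (length-map g τ) , orderIso-map τ<))
    where
    compare : ∀ {τ} → All (_< m) τ →
      All (λ p → T (((g t <ᵇ proj₁ p) ⇔ᵇ (t <ᵇ proj₂ p)) ∧ ((proj₁ p <ᵇ g t) ⇔ᵇ (proj₂ p <ᵇ t)))) (zip (map g τ) τ)
    compare [] = []
    compare (u< ∷ τ<) = Equivalence.from T-∧ (agree t< u< , agree u< t<) ∷ compare τ<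

at : List ℕ → ℕ → ℕ
at [] _ = 0
at (x ∷ xs) zero = x
at (x ∷ xs) (suc i) = at xs i

at-mono : ∀ {xs} → AllPairs _<_ xs → ∀ {i j} → i < j → j < length xs → at xs i < at xs j
at-mono (x< ∷ xs<) {zero} {suc j} _ (s≤s j<) = lookup x< j<
  where
  lookup : ∀ {x xs j} → All (x <_) xs → j < length xs → x < at xs j
  lookup {j = zero} (x< ∷ _) _ = x<
  lookup {j = suc j} (_ ∷ a) (s≤s j<) = lookup a j<
at-mono (_ ∷ xs<) {suc i} {suc j} (s≤s i<j) (s≤s j<) = at-mono xs< i<j j<

at-++ : ∀ xs y ys → at (xs ++ y ∷ ys) (length xs) ≡ y
at-++ [] y ys = refl
at-++ (x ∷ xs) y ys = at-++ xs y ys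

map-at : ∀ xs ys zs → map (at (xs ++ ys ++ zs)) (interval (length xs) (length ys)) ≡ ys
map-at xs [] zs = refl
map-at xs (y ∷ ys) zs = cong₂ _∷_ (at-++ xs y (ys ++ zs)) (begin
  map (at (xs ++ y ∷ ys ++ zs)) (interval (suc (length xs)) (length ys))
    ≡⟨ cong₂ (λ l i → map (at l) (interval i (length ys))) (sym (++-assoc xs (y ∷ []) (ys ++ zs)))
         (sym (trans (length-++ xs) (+-comm (length xs) 1))) ⟩
  map (at ((xs ++ y ∷ []) ++ ys ++ zs)) (interval (length (xs ++ y ∷ [])) (length ys))
    ≡⟨ map-at (xs ++ y ∷ []) ys zs ⟩
  ys ∎)
  where open ≡-Reasoning

pick : {A : Set} → Bool → A → A → A
pick true x y = x
pick false x y = y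

blocks : {A : Set} → A → List A → A → A → List A → A → List A
blocks a us x y ls b = a ∷ us ++ x ∷ y ∷ ls ++ b ∷ []

-- The k-gon patterns for k = 2 + m: the values k, k + 1 and the positions of 1, 2k are swapped independently.
gon : ℕ → Bool → Bool → List ℕ
gon m b c = blocks (pick b (2 + m) (3 + m)) (interval (4 + m) m) (pick c 1 (m + (4 + m))) (pick c (m + (4 + m)) 1)
  (interval 2 m) (pick b (3 + m) (2 + m))

interval-< : ∀ a m → All (_< m + a) (interval a m)
interval-< a zero = []
interval-< a (suc m) = s≤s (m≤n+m a m) ∷ subst (λ c → All (_< c) (interval (suc a) m)) (+-suc m a) (interval-< (suc a) m)

interval-∷ʳ : ∀ a m → interval a (suc m) ≡ interval a m ++ (m + a) ∷ []
interval-∷ʳ a m = trans (cong (interval a) (sym (+-comm m 1))) (interval-++ a m 1)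

module _ (m : ℕ) where
  private
    k = 2 + m

    2k≡ : 2 * k ≡ m + (4 + m)
    2k≡ = lemma m
      where
      lemma : ∀ m → 2 * (2 + m) ≡ m + (4 + m)
      lemma = NatSolver.solve-∀

    k+1≡ : k + 1 ≡ 3 + m
    k+1≡ = +-comm k 1

    k+2≡ : k + 2 ≡ 4 + m
    k+2≡ = +-comm k 2

    range≡ : ∀ {a b} c l → a ≡ c → suc b ≡ l + c → range a b ≡ interval c l
    range≡ {a} {b} c l refl eq = trans (range≡interval a b) (cong (interval a) (trans (cong (_∸ a) eq) (m+n∸n≡m l a)))

    big : range (k + 2) (2 * k ∸ 1) ≡ interval (4 + m) m
    big = range≡ (4 + m) m k+2≡ 2k≡

    big⁺ : range (k + 2) (2 * k) ≡ interval (4 + m) m ++ (m + (4 + m)) ∷ []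
    big⁺ = trans (range≡ (4 + m) (suc m) k+2≡ (cong suc 2k≡)) (interval-∷ʳ (4 + m) m)

    big₁ : range (k + 1) (2 * k ∸ 1) ≡ 3 + m ∷ interval (4 + m) m
    big₁ = range≡ (3 + m) (suc m) k+1≡ (trans 2k≡ (+-suc m (3 + m)))

    big₁⁺ : range (k + 1) (2 * k) ≡ 3 + m ∷ interval (4 + m) m ++ (m + (4 + m)) ∷ []
    big₁⁺ = trans (range≡ (3 + m) (2 + m) k+1≡ (cong suc (trans 2k≡ (+-suc m (3 + m)))))
      (cong (3 + m ∷_) (interval-∷ʳ (4 + m) m))

    small : range 2 (k ∸ 1) ≡ interval 2 m
    small = range≡interval 2 (k ∸ 1)

    small⁺ : range 2 k ≡ interval 2 m ++ (2 + m) ∷ []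
    small⁺ = trans (range≡interval 2 k) (trans (interval-∷ʳ 2 m) (cong (λ c → interval 2 m ++ c ∷ []) (+-comm m 2)))

  pat1≡ : pat1 k ≡ gon m true true
  pat1≡ = trans
    (cong₂ (λ xs c → k ∷ xs ++ 1 ∷ c ∷ range 2 (k ∸ 1) ++ k + 1 ∷ []) big 2k≡)
    (cong₂ (λ xs c → k ∷ interval (4 + m) m ++ 1 ∷ m + (4 + m) ∷ xs ++ c ∷ []) small k+1≡)

  pat2≡ : pat2 k ≡ gon m true false
  pat2≡ = trans
    (cong₂ (λ xs ys → k ∷ xs ++ 1 ∷ ys ++ k + 1 ∷ []) big⁺ small)
    (trans (cong (λ c → k ∷ (interval (4 + m) m ++ m + (4 + m) ∷ []) ++ 1 ∷ interval 2 m ++ c ∷ []) k+1≡)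
      (cong (k ∷_) (++-assoc (interval (4 + m) m) (m + (4 + m) ∷ []) _)))

  pat3≡ : pat3 k ≡ gon m false true
  pat3≡ = trans
    (cong₂ (λ xs c → xs ++ 1 ∷ c ∷ range 2 k) big₁ 2k≡)
    (cong (λ xs → 3 + m ∷ interval (4 + m) m ++ 1 ∷ m + (4 + m) ∷ xs) small⁺)

  pat4≡ : pat4 k ≡ gon m false false
  pat4≡ = trans
    (cong₂ (λ xs ys → xs ++ 1 ∷ ys) big₁⁺ small⁺)
    (cong (3 + m ∷_) (++-assoc (interval (4 + m) m) (m + (4 + m) ∷ []) _))

  kGonAvoiding⁺ : ∀ {w} → (∀ b c → ¬ Contains w (gon m b c)) → T (kGonAvoidingᵇ k w)
  kGonAvoiding⁺ ¬c =
    Equivalence.from T-∧ (avoids⁺ (subst (¬_ ∘ Contains _) (sym pat1≡) (¬c true true)) ,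
    Equivalence.from T-∧ (avoids⁺ (subst (¬_ ∘ Contains _) (sym pat2≡) (¬c true false)) ,
    Equivalence.from T-∧ (avoids⁺ (subst (¬_ ∘ Contains _) (sym pat3≡) (¬c false true)) ,
    avoids⁺ (subst (¬_ ∘ Contains _) (sym pat4≡) (¬c false false)))))

  kGonAvoiding⁻ : ∀ {w} → T (kGonAvoidingᵇ k w) → ∀ b c → ¬ Contains w (gon m b c)
  kGonAvoiding⁻ {w} t
    with t₁ , t′ ← Equivalence.to (T-∧ {avoidsᵇ w (pat1 k)}) t
    with t₂ , t″ ← Equivalence.to (T-∧ {avoidsᵇ w (pat2 k)}) t′
    with t₃ , t₄ ← Equivalence.to (T-∧ {avoidsᵇ w (pat3 k)}) t″ = λ where
      true true → subst (¬_ ∘ Contains w) pat1≡ (avoids⁻ t₁)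
      true false → subst (¬_ ∘ Contains w) pat2≡ (avoids⁻ t₂)
      false true → subst (¬_ ∘ Contains w) pat3≡ (avoids⁻ t₃)
      false false → subst (¬_ ∘ Contains w) pat4≡ (avoids⁻ t₄)

-- Two sorted chains realise a pattern as the images of its entries under the enumeration of their union.
gon-orderIso : ∀ {m} d ls lo hi us e → length ls ≡ m → length us ≡ m →
  AllPairs _<_ (0 ∷ d ∷ ls ++ lo ∷ hi ∷ us ++ e ∷ []) → ∀ b c →
  T (orderIso (blocks (pick b lo hi) us (pick c d e) (pick c e d) ls (pick b hi lo)) (gon m b c))
gon-orderIso {m} d ls lo hi us e |ls| |us| sorted b c =
  subst (λ s → T (orderIso s (gon m b c))) image (orderIso-map g (5 + (m + m)) mono below)
  where
  -- The leading 0 makes each pattern value the index of its image: d has index 1, `lo` and `hi`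
  -- have k and k + 1, and e has 2k.
  q = 0 ∷ d ∷ ls ++ lo ∷ hi ∷ us ++ e ∷ []
  g = at q
  |q| : length q ≡ 5 + (m + m)
  |q| = cong (λ i → 2 + i) (begin
    length (ls ++ lo ∷ hi ∷ us ++ e ∷ [])    ≡⟨ length-++ ls ⟩
    length ls + (2 + length (us ++ e ∷ []))  ≡⟨ cong (λ x → length ls + (2 + x)) (length-++ us) ⟩
    length ls + (2 + (length us + 1))        ≡⟨ cong₂ (λ x y → x + (2 + (y + 1))) |ls| |us| ⟩
    m + (2 + (m + 1))                        ≡⟨ lemma m ⟩
    3 + (m + m) ∎)
    where
    open ≡-Reasoning
    lemma : ∀ m → m + (2 + (m + 1)) ≡ 3 + (m + m)
    lemma = NatSolver.solve-∀
  mono : ∀ {t u} → t < u → u < 5 + (m + m) → g t < g u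
  mono {u = u} t<u u< = at-mono sorted t<u (subst (u <_) (sym |q|) u<)
  g-ls : map g (interval 2 m) ≡ ls
  g-ls = subst (λ x → map g (interval 2 x) ≡ ls) |ls| (map-at (0 ∷ d ∷ []) ls (lo ∷ hi ∷ us ++ e ∷ []))
  g-tail : map g (interval (2 + m) (2 + m + 1)) ≡ lo ∷ hi ∷ us ++ e ∷ []
  g-tail = subst₂ (λ x y → map g (interval (2 + x) y) ≡ lo ∷ hi ∷ us ++ e ∷ []) |ls|
    (cong (λ i → 2 + i) (trans (length-++ us) (cong (_+ 1) |us|)))
    (subst (λ zs → map (at (0 ∷ d ∷ ls ++ zs)) (interval (2 + length ls) (2 + length (us ++ e ∷ []))) ≡ lo ∷ hi ∷ us ++ e ∷ [])
      (++-identityʳ _) (map-at (0 ∷ d ∷ ls) (lo ∷ hi ∷ us ++ e ∷ []) []))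
  tail≡ = ∷-injective (proj₂ (∷-injective g-tail))
  last≡ : map g (interval (4 + m) m) ∷ʳ g (m + (4 + m)) ≡ us ∷ʳ e
  last≡ = begin
    map g (interval (4 + m) m) ∷ʳ g (m + (4 + m)) ≡⟨ map-++ g (interval (4 + m) m) _ ⟨
    map g (interval (4 + m) m ++ (m + (4 + m)) ∷ []) ≡⟨ cong (map g) (interval-++ (4 + m) m 1) ⟨
    map g (interval (4 + m) (m + 1)) ≡⟨ proj₂ tail≡ ⟩
    us ∷ʳ e ∎
    where open ≡-Reasoning
  g-us : map g (interval (4 + m) m) ≡ us
  g-us = proj₁ (∷ʳ-injective (map g (interval (4 + m) m)) us last≡)
  g-e : g (m + (4 + m)) ≡ e
  g-e = proj₂ (∷ʳ-injective (map g (interval (4 + m) m)) us last≡)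
  g-pick : ∀ b {t u x y} → g t ≡ x → g u ≡ y → g (pick b t u) ≡ pick b x y
  g-pick true eq _ = eq
  g-pick false _ eq = eq
  g-lo : g (2 + m) ≡ lo
  g-lo = proj₁ (∷-injective g-tail)
  g-hi : g (3 + m) ≡ hi
  g-hi = proj₁ tail≡
  map-blocks : ∀ a us x y ls b → map g (blocks a us x y ls b) ≡ blocks (g a) (map g us) (g x) (g y) (map g ls) (g b)
  map-blocks a us x y ls b = cong (g a ∷_) (trans (map-++ g us _)
    (cong (λ zs → map g us ++ g x ∷ g y ∷ zs) (map-++ g ls _)))
  blocks-cong : ∀ {a a′ : ℕ} {us us′ x x′ y y′ ls ls′ b b′} → a ≡ a′ → us ≡ us′ → x ≡ x′ → y ≡ y′ → ls ≡ ls′ → b ≡ b′ →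
    blocks a us x y ls b ≡ blocks a′ us′ x′ y′ ls′ b′
  blocks-cong refl refl refl refl refl refl = refl
  image : map g (gon m b c) ≡ blocks (pick b lo hi) us (pick c d e) (pick c e d) ls (pick b hi lo)
  image = trans
    (map-blocks (pick b (2 + m) (3 + m)) (interval (4 + m) m) (pick c 1 (m + (4 + m))) (pick c (m + (4 + m)) 1)
      (interval 2 m) (pick b (3 + m) (2 + m)))
    (blocks-cong (g-pick b g-lo g-hi) g-us (g-pick c refl g-e) (g-pick c g-e refl) g-ls (g-pick b g-hi g-lo))
  bound : ∀ b {t u} → t < 5 + (m + m) → u < 5 + (m + m) → pick b t u < 5 + (m + m)
  bound true t< _ = t<
  bound false _ u< = u<
  k< : 3 + m < 5 + (m + m)
  k< = s≤s (s≤s (s≤s (s≤s (≤-trans (m≤m+n m m) (n≤1+n _)))))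
  2k< : m + (4 + m) < 5 + (m + m)
  2k< = ≤-reflexive (cong suc (trans (+-comm m (4 + m)) refl))
  below : All (_< 5 + (m + m)) (gon m b c)
  below =
    bound b (<⇒≤ k<) k< ∷
    Allₚ.++⁺ (All.map (λ t< → <-trans t< 2k<) (interval-< (4 + m) m))
      (bound c (s≤s (s≤s z≤n)) 2k< ∷ bound c 2k< (s≤s (s≤s z≤n)) ∷
    Allₚ.++⁺ (All.map (λ t< → <-≤-trans t< (≤-trans (≤-reflexive (+-comm m 2)) (<⇒≤ (<⇒≤ k<)))) (interval-< 2 m))
      (bound b k< (<⇒≤ k<) ∷ []))

-- The path of a permutation

AllPairs-resp-⊆ : {A : Set} {R : A → A → Set} {xs ys : List A} → xs ⊆ ys → AllPairs R ys → AllPairs R xs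
AllPairs-resp-⊆ [] [] = []
AllPairs-resp-⊆ (_ Sublist.∷ʳ p) (_ ∷ rs) = AllPairs-resp-⊆ p rs
AllPairs-resp-⊆ (refl ∷ p) (r ∷ rs) = All-resp-⊆ p r ∷ AllPairs-resp-⊆ p rs

module _ {A B : Set} (f : A → B) where

  ⊆-map⁻ : ∀ {s} w → s ⊆ map f w → ∃ λ v → v ⊆ w × s ≡ map f v
  ⊆-map⁻ [] [] = [] , [] , refl
  ⊆-map⁻ (x ∷ w) (_ Sublist.∷ʳ p) with v , q , refl ← ⊆-map⁻ w p = v , x Sublist.∷ʳ q , refl
  ⊆-map⁻ (x ∷ w) (refl ∷ p) with v , q , refl ← ⊆-map⁻ w p = x ∷ v , refl ∷ q , refl

  map-split : ∀ w {xs ys} → map f w ≡ xs ++ ys → ∃₂ λ u v → w ≡ u ++ v × map f u ≡ xs × map f v ≡ ys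
  map-split w {[]} eq = [] , w , refl , refl , eq
  map-split (a ∷ w) {x ∷ xs} eq with u , v , refl , eqˡ , eqʳ ← map-split w {xs} (∷-injectiveʳ eq) =
    a ∷ u , v , refl , cong₂ _∷_ (∷-injectiveˡ eq) eqˡ , eqʳ

-- Levi's lemma for two factorisations of one list.
prefix-split : {A : Set} (xs : List A) {ys us vs : List A} → xs ++ ys ≡ us ++ vs → length xs ≤ length us →
  ∃ λ zs → us ≡ xs ++ zs × ys ≡ zs ++ vs
prefix-split [] {us = us} eq _ = us , refl , eq
prefix-split (x ∷ xs) {us = _ ∷ us} eq (s≤s len) with refl , eq′ ← ∷-injective eq
  with zs , refl , eq″ ← prefix-split xs {us = us} eq′ len = zs , refl , eq″

-- The middle entry of a 321 ends one inversion and starts another, so it would be both a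
-- non-maximum and a maximum.
ordered⇒avoids-321 : ∀ w → AllPairs Ordered w → ¬ Contains (entries w) (3 ∷ 2 ∷ 1 ∷ [])
ordered⇒avoids-321 w ord (s , s⊆ , iso)
  with v , v⊆ , refl ← ⊆-map⁻ proj₂ w s⊆
  with len , same ← orderIso⁻ (entries v) _ iso = absurd v len same (AllPairs-resp-⊆ v⊆ ord)
  where
  absurd : ∀ v → length (entries v) ≡ 3 → AllPairs SameOrder (zip (entries v) (3 ∷ 2 ∷ 1 ∷ [])) → ¬ AllPairs Ordered v
  absurd ((_ , a) ∷ (_ , b) ∷ (_ , c) ∷ []) _ ((ab ∷ _) ∷ (bc ∷ _) ∷ _) ((o ∷ _) ∷ (o′ ∷ _) ∷ _)
    with o | o′
  ... | inj₁ a<b | _ = <-asym a<b (proj₂ ab (s≤s (s≤s (s≤s z≤n))))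
  ... | inj₂ _ | inj₁ b<c = <-asym b<c (proj₂ bc (s≤s (s≤s z≤n)))
  ... | inj₂ (_ , refl) | inj₂ (() , _)

count-++ : ∀ b xs ys → count b (xs ++ ys) ≡ count b xs + count b ys
count-++ true [] ys = refl
count-++ false [] ys = refl
count-++ true (true ∷ xs) ys = cong suc (count-++ true xs ys)
count-++ true (false ∷ xs) ys = count-++ true xs ys
count-++ false (true ∷ xs) ys = count-++ false xs ys
count-++ false (false ∷ xs) ys = cong suc (count-++ false xs ys)

count-total : ∀ bs → count true bs + count false bs ≡ length bs
count-total [] = refl
count-total (true ∷ bs) = cong suc (count-total bs)
count-total (false ∷ bs) = trans (+-suc _ _) (cong suc (count-total bs))

places-++ : ∀ b i xs ys → places b i (xs ++ ys) ≡ places b i xs ++ places b (length xs + i) ys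
places-++ true i [] ys = refl
places-++ false i [] ys = refl
places-++ true i (true ∷ xs) ys =
  cong (i ∷_) (trans (places-++ true (suc i) xs ys) (cong (λ j → places true (suc i) xs ++ places true j ys) (+-suc (length xs) i)))
places-++ true i (false ∷ xs) ys =
  trans (places-++ true (suc i) xs ys) (cong (λ j → places true (suc i) xs ++ places true j ys) (+-suc (length xs) i))
places-++ false i (true ∷ xs) ys =
  trans (places-++ false (suc i) xs ys) (cong (λ j → places false (suc i) xs ++ places false j ys) (+-suc (length xs) i))
places-++ false i (false ∷ xs) ys =
  cong (i ∷_) (trans (places-++ false (suc i) xs ys) (cong (λ j → places false (suc i) xs ++ places false j ys) (+-suc (length xs) i)))

places-< : ∀ b i bs → All (_< length bs + i) (places b i bs)
places-< true i [] = []
places-< false i [] = []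
places-< true i (true ∷ bs) =
  s≤s (m≤n+m i _) ∷ subst (λ j → All (_< j) (places true (suc i) bs)) (+-suc (length bs) i) (places-< true (suc i) bs)
places-< true i (false ∷ bs) = subst (λ j → All (_< j) (places true (suc i) bs)) (+-suc (length bs) i) (places-< true (suc i) bs)
places-< false i (true ∷ bs) = subst (λ j → All (_< j) (places false (suc i) bs)) (+-suc (length bs) i) (places-< false (suc i) bs)
places-< false i (false ∷ bs) =
  s≤s (m≤n+m i _) ∷ subst (λ j → All (_< j) (places false (suc i) bs)) (+-suc (length bs) i) (places-< false (suc i) bs)

module _ (b : Bool) (us vs : List Bool) {X Y : List ℕ} (eq : places b 1 (us ++ vs) ≡ X ++ Y) where

  -- The marked indices are listed in increasing order and exactly `count b us` of them belong to
  -- `us`, so comparing a length with this count locates a block relative to the cut.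
  early-places : length X ≤ count b us → All (_≤ length us) X
  early-places len with zs , eqˡ , _ ← prefix-split X (trans (sym eq) (places-++ b 1 us vs))
                                    (subst (length X ≤_) (sym (length-places b 1 us)) len) =
    Allₚ.++⁻ˡ X (subst (All (_≤ length us)) eqˡ
      (All.map (λ {x} x< → ≤-pred (subst (x <_) (+-comm (length us) 1) x<)) (places-< b 1 us)))

  late-places : count b us ≤ length X → All (length us <_) Y
  late-places len with zs , _ , eqʳ ← prefix-split (places b 1 us) (trans (sym (places-++ b 1 us vs)) eq)
                                   (subst (_≤ length X) (sym (length-places b 1 us)) len) =
    Allₚ.++⁻ʳ zs (subst (All (length us <_)) eqʳ
      (subst (λ i → All (i ≤_) (places b i′ vs)) (+-comm (length us) 1) (places-≥ b i′ vs)))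
    where i′ = length us + 1

entriesOf-++ : ∀ b u v → entriesOf b (u ++ v) ≡ entriesOf b u ++ entriesOf b v
entriesOf-++ true [] v = refl
entriesOf-++ false [] v = refl
entriesOf-++ true ((true , x) ∷ u) v = cong (x ∷_) (entriesOf-++ true u v)
entriesOf-++ true ((false , x) ∷ u) v = entriesOf-++ true u v
entriesOf-++ false ((true , x) ∷ u) v = entriesOf-++ false u v
entriesOf-++ false ((false , x) ∷ u) v = cong (x ∷_) (entriesOf-++ false u v)

length-entriesOf : ∀ b w → length (entriesOf b w) ≡ count b (labels w)
length-entriesOf true [] = refl
length-entriesOf false [] = refl
length-entriesOf true ((true , x) ∷ w) = cong suc (length-entriesOf true w)
length-entriesOf true ((false , x) ∷ w) = length-entriesOf true w
length-entriesOf false ((true , x) ∷ w) = length-entriesOf false w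
length-entriesOf false ((false , x) ∷ w) = cong suc (length-entriesOf false w)

length-P : ∀ π → length (P π) ≡ length π
length-P = length-map posE

length-V : ∀ π → length (V π) ≡ length π
length-V = length-map valE

balance : ∀ ρ → count true (P ρ) ≡ count true (V ρ) → count false (P ρ) ≡ count false (V ρ)
balance ρ eq = +-cancelˡ-≡ (count true (P ρ)) _ _ (begin
  count true (P ρ) + count false (P ρ) ≡⟨ count-total (P ρ) ⟩
  length (P ρ)                         ≡⟨ trans (length-P ρ) (sym (length-V ρ)) ⟩
  length (V ρ)                         ≡⟨ count-total (V ρ) ⟨
  count true (V ρ) + count false (V ρ) ≡⟨ cong (_+ count false (V ρ)) eq ⟨
  count true (P ρ) + count false (V ρ) ∎)
  where open ≡-Reasoning

module _ {w π} (c : Codes w π) where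
  open Codes c

  codes-balanced : count true (P π) ≡ count true (V π)
  codes-balanced = begin
    count true (P π)          ≡⟨ cong (count true) codes-labels ⟨
    count true (labels w)     ≡⟨ length-entriesOf true w ⟨
    length (entriesOf true w) ≡⟨ cong length (codes-entries true) ⟩
    length (places true 1 (V π)) ≡⟨ length-places true 1 (V π) ⟩
    count true (V π) ∎
    where open ≡-Reasoning

-- Labelling by left-to-right maxima

lr : ℕ → List ℕ → List (Bool × ℕ)
lr M [] = []
lr M (x ∷ w) with M <? x
... | yes _ = (true , x) ∷ lr x w
... | no _ = (false , x) ∷ lr M w

entries-lr : ∀ M w → entries (lr M w) ≡ w
entries-lr M [] = refl
entries-lr M (x ∷ w) with M <? x
... | yes _ = cong (x ∷_) (entries-lr x w)
... | no _ = cong (x ∷_) (entries-lr M w)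

lr-maxima : ∀ M w → All (M <_) (entriesOf true (lr M w)) × AllPairs _<_ (entriesOf true (lr M w))
lr-maxima M [] = [] , []
lr-maxima M (x ∷ w) with M <? x
... | yes M<x = M<x ∷ All.map (<-trans M<x) (proj₁ (lr-maxima x w)) , proj₁ (lr-maxima x w) ∷ proj₂ (lr-maxima x w)
... | no _ = lr-maxima M w

entriesOf-⊆ : ∀ b w → entriesOf b w ⊆ entries w
entriesOf-⊆ true [] = []
entriesOf-⊆ false [] = []
entriesOf-⊆ true ((true , x) ∷ w) = refl ∷ entriesOf-⊆ true w
entriesOf-⊆ true ((false , x) ∷ w) = x Sublist.∷ʳ entriesOf-⊆ true w
entriesOf-⊆ false ((true , x) ∷ w) = x Sublist.∷ʳ entriesOf-⊆ false w
entriesOf-⊆ false ((false , x) ∷ w) = refl ∷ entriesOf-⊆ false w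

No321 : List ℕ → Set
No321 w = ∀ {a b c} → a ∷ b ∷ c ∷ [] ⊆ w → c < b → b < a → ⊥

-- A smaller entry after the non-maximum x would complete a 321 that begins with the running
-- maximum. This is why M stays in front of w in the hypotheses.
lr-others : ∀ M w → Unique (M ∷ w) → No321 (M ∷ w) → AllPairs _<_ (entriesOf false (lr M w))
lr-others M [] _ _ = []
lr-others M (x ∷ w) ((M≢x ∷ M∉) ∷ (x∉ ∷ w!)) av with M <? x
... | yes _ = lr-others x w (x∉ ∷ w!) (λ s → av (M Sublist.∷ʳ s))
... | no M≮x =
  All.tabulate above ∷ lr-others M w (M∉ ∷ w!) (λ s → av (⊆-trans s (refl ∷ x Sublist.∷ʳ ⊆-refl)))
  where
  above : ∀ {y} → y ∈ entriesOf false (lr M w) → x < y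
  above {y} y∈ with y∈w ← subst (y ∈_) (entries-lr M w) (Sublist.lookup (entriesOf-⊆ false (lr M w)) y∈) =
    ≤∧≢⇒< (≮⇒≥ (λ y<x → av (refl ∷ refl ∷ from∈ y∈w) y<x (≤∧≢⇒< (≮⇒≥ M≮x) (M≢x ∘ sym)))) (All.lookup x∉ y∈w)

lr-dominated : ∀ M w u {x v} → lr M w ≡ u ++ (false , x) ∷ v → x ≤ M ⊎ ∃ λ y → y ∈ entriesOf true u × x ≤ y
lr-dominated M [] [] ()
lr-dominated M [] (_ ∷ _) ()
lr-dominated M (x ∷ w) u eq with M <? x
lr-dominated M (x ∷ w) (_ ∷ u) eq | yes _ with refl , eq′ ← ∷-injective eq with lr-dominated x w u eq′
... | inj₁ z≤x = inj₂ (x , here refl , z≤x)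
... | inj₂ (y , y∈ , z≤y) = inj₂ (y , there y∈ , z≤y)
lr-dominated M (x ∷ w) [] refl | no M≮x = inj₁ (≮⇒≥ M≮x)
lr-dominated M (x ∷ w) (_ ∷ u) eq | no _ with refl , eq′ ← ∷-injective eq = lr-dominated M w u eq′

∈-sorted-min : ∀ {a xs} → AllPairs _<_ xs → All (a ≤_) xs → a ∈ xs → ∃ λ ys → xs ≡ a ∷ ys
∈-sorted-min {xs = x ∷ xs} _ _ (here refl) = xs , refl
∈-sorted-min {xs = x ∷ xs} (x< ∷ _) (a≤x ∷ _) (there a∈) = contradiction (All.lookup x< a∈) (≤⇒≯ a≤x)

-- The least value a heads one of the two lists, and the first bit records which.
sorted-split : ∀ a m es ds → AllPairs _<_ es → AllPairs _<_ ds → es ++ ds ↭ interval a m →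
  ∃ λ bs → length bs ≡ m × es ≡ places true a bs × ds ≡ places false a bs
sorted-split a zero es ds _ _ p with es | ds | ↭-empty-inv p
... | [] | [] | _ = [] , refl , refl , refl
sorted-split a (suc m) es ds es< ds< p
  with Allₚ.++⁻ es (All.tabulate {xs = es ++ ds} (λ x∈ → All.lookup (interval-≥ a (suc m)) (∈-resp-↭ p x∈)))
     | ∈-++⁻ es (∈-resp-↭ (↭-sym p) (here refl))
... | es≥ , _ | inj₁ a∈
  with es′ , refl ← ∈-sorted-min es< es≥ a∈
  with bs , len , refl , refl ← sorted-split (suc a) m es′ ds (AllPairs.tail es<) ds< (drop-∷ p) =
  true ∷ bs , cong suc len , refl , refl
... | _ , ds≥ | inj₂ a∈
  with ds′ , refl ← ∈-sorted-min ds< ds≥ a∈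
  with bs , len , refl , refl ← sorted-split (suc a) m es ds′ es< (AllPairs.tail ds<) (drop-∷ (↭-trans (↭-sym (shift a es ds′)) p)) =
  false ∷ bs , cong suc len , refl , refl

from-bits : ∀ bs cs → length bs ≡ length cs → ∃ λ π → P π ≡ bs × V π ≡ cs
from-bits [] [] _ = [] , refl , refl
from-bits (b ∷ bs) (c ∷ cs) len with π , refl , refl ← from-bits bs cs (suc-injective len) = cons b c
  where
  cons : ∀ b c → ∃ λ π′ → P π′ ≡ b ∷ P π × V π′ ≡ c ∷ V π
  cons true true = flatE ∷ π , refl , refl
  cons true false = up ∷ π , refl , refl
  cons false true = down ∷ π , refl , refl
  cons false false = flatD ∷ π , refl , refl

no321-0 : ∀ {w} → No321 w → No321 (0 ∷ w)
no321-0 av (_ Sublist.∷ʳ s) = av s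
no321-0 av (refl ∷ s) _ ()

module _ {n w} (w↭ : w ↭ interval 1 n) where

  perm-positive : All (1 ≤_) w
  perm-positive = All.tabulate (λ x∈ → All.lookup (interval-≥ 1 n) (∈-resp-↭ w↭ x∈))

  avoids⇒no321 : ¬ Contains w (3 ∷ 2 ∷ 1 ∷ []) → No321 w
  avoids⇒no321 av {a} {b} {c} s c<b b<a =
    av (a ∷ b ∷ c ∷ [] , s , orderIso-map (at (0 ∷ c ∷ b ∷ a ∷ [])) 4
      (at-mono ((0<c ∷ <-trans 0<c c<b ∷ <-trans 0<c (<-trans c<b b<a) ∷ []) ∷ (c<b ∷ <-trans c<b b<a ∷ []) ∷ (b<a ∷ []) ∷ [] ∷ []))
      (≤-refl ∷ s≤s (s≤s (s≤s z≤n)) ∷ s≤s (s≤s z≤n) ∷ []))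
    where
    0<c : 0 < c
    0<c with _ ∷ _ ∷ 0<c ∷ [] ← All-resp-⊆ s perm-positive = 0<c

  length-labels : ∀ M → length (labels (lr M w)) ≡ n
  length-labels M = begin
    length (labels (lr M w))  ≡⟨ length-map proj₁ (lr M w) ⟩
    length (lr M w)           ≡⟨ length-map proj₂ (lr M w) ⟨
    length (entries (lr M w)) ≡⟨ cong length (entries-lr M w) ⟩
    length w                  ≡⟨ trans (↭-length w↭) (length-interval 1 n) ⟩
    n                         ∎
    where open ≡-Reasoning

  encode : No321 w → ∃ λ π → Codes (lr 0 w) π
  encode av
    with bs , len , eqE , eqD ← sorted-split 1 n (entriesOf true (lr 0 w)) (entriesOf false (lr 0 w))
                                  (proj₂ (lr-maxima 0 w))
                                  (lr-others 0 w (All.map <⇒≢ perm-positive ∷ ↭-interval⇒unique 1 n w↭) (no321-0 av))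
                                  (↭-trans (↭-sym (entries-↭ (lr 0 w))) (subst (_↭ interval 1 n) (sym (entries-lr 0 w)) w↭))
    with π , P≡ , V≡ ← from-bits (labels (lr 0 w)) bs (trans (length-labels 0) (sym len)) =
    π , record
      { codes-labels = sym P≡
      ; codes-entries = λ { true → trans eqE (cong (places true 1) (sym V≡))
                          ; false → trans eqD (cong (places false 1) (sym V≡)) } }

-- The same word is cut in two ways, after as many positions and after as many values as ρ has
-- steps.
record CodesAt (w : List (Bool × ℕ)) (ρ σ : List Step) : Set where
  field
    {before after} : List (Bool × ℕ)
    w≡ : w ≡ before ++ after
    labels-before : labels before ≡ P ρ
    labels-after : labels after ≡ P σ
    places≡ : ∀ b → places b 1 (V ρ ++ V σ) ≡ entriesOf b before ++ entriesOf b after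
    length-before : ∀ b → length (entriesOf b before) ≡ count b (P ρ)

codes-at : ∀ {w} ρ σ → Codes w (ρ ++ σ) → CodesAt w ρ σ
codes-at {w} ρ σ c with u , v , refl , eqˡ , eqʳ ← map-split proj₁ w (trans (Codes.codes-labels c) (map-++ posE ρ σ)) = record
  { w≡ = refl
  ; labels-before = eqˡ
  ; labels-after = eqʳ
  ; places≡ = λ b → trans (cong (places b 1) (sym (map-++ valE ρ σ))) (trans (sym (Codes.codes-entries c b)) (entriesOf-++ b u v))
  ; length-before = λ b → trans (length-entriesOf b u) (cong (count b) eqˡ)
  }

-- If as many maxima have been placed as occur among the smallest values, a non-maximum cannot
-- follow: it would be larger than every earlier entry.
lr-allowed : ∀ {w} ρ y σ → All (1 ≤_) w → Codes (lr 0 w) (ρ ++ y ∷ σ) →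
  count true (P ρ) ≡ count true (V ρ) → posE y ≡ true
lr-allowed {w} ρ y σ pos c eq with posE y in py
... | true = refl
... | false = ⊥-elim (absurd (codes-at ρ (y ∷ σ) c))
  where
  split-after : ∀ v → labels v ≡ false ∷ P σ → ∃₂ λ x v′ → v ≡ (false , x) ∷ v′
  split-after ((false , x) ∷ v′) _ = x , v′ , refl
  absurd : CodesAt (lr 0 w) ρ (y ∷ σ) → ⊥
  absurd record { before = u ; after = v ; w≡ = w≡ ; labels-after = eqʳ ; places≡ = places≡ ; length-before = len }
    with x , v′ , refl ← split-after v (trans eqʳ (cong (_∷ P σ) py))
    with x> ∷ _ ← late-places false (V ρ) (V (y ∷ σ)) {entriesOf false u} (places≡ false)
                    (≤-reflexive (trans (sym (balance ρ eq)) (sym (len false))))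
    with lr-dominated 0 w u w≡
  ... | inj₁ x≤0 = <⇒≱ x> (≤-trans x≤0 z≤n)
  ... | inj₂ (z , z∈ , x≤z) = <⇒≱ x> (≤-trans x≤z (All.lookup
          (early-places true (V ρ) (V (y ∷ σ)) {entriesOf true u} (places≡ true)
            (≤-reflexive (trans (len true) eq))) z∈))

-- Here c is the height reached after the prefix. The balance survives one more step unless `down`
-- is taken at height 0, where `pred` truncates; the condition on y excludes that.
move-count⁺ : ∀ {h} y ρ c → (h ≡ 0 → posE y ≡ true) →
  move h y + count true (P ρ) ≡ c + count true (V ρ) → h + count true (P (y ∷ ρ)) ≡ c + count true (V (y ∷ ρ))
move-count⁺ up ρ c _ eq = trans (+-suc _ _) eq
move-count⁺ {zero} down ρ c allowed eq with () ← allowed refl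
move-count⁺ {suc h} down ρ c _ eq = trans (cong suc eq) (sym (+-suc c _))
move-count⁺ flatE ρ c _ eq = trans (+-suc _ _) (trans (cong suc eq) (sym (+-suc c _)))
move-count⁺ flatD ρ c _ eq = eq

move-count⁻ : ∀ {h} y ρ c → (h ≡ 0 → posE y ≡ true) →
  h + count true (P (y ∷ ρ)) ≡ c + count true (V (y ∷ ρ)) → move h y + count true (P ρ) ≡ c + count true (V ρ)
move-count⁻ up ρ c _ eq = trans (sym (+-suc _ _)) eq
move-count⁻ {zero} down ρ c allowed eq with () ← allowed refl
move-count⁻ {suc h} down ρ c _ eq = suc-injective (trans eq (+-suc c _))
move-count⁻ flatE ρ c _ eq = suc-injective (trans (sym (+-suc _ _)) (trans eq (+-suc c _)))
move-count⁻ flatD ρ c _ eq = eq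

-- Turns conditions on all prefixes into the local conditions of `Path`. The factorisations in the
-- second condition include x, since the first step of π is restricted by it.
path⁺ : ∀ {K} g x π → (g ≡ 0 → posE x ≡ true) →
  (∀ ρ y σ → π ≡ ρ ++ y ∷ σ → move g x + count true (P ρ) ≡ count true (V ρ) → posE y ≡ true) →
  (∀ h ρ y z σ → x ∷ π ≡ ρ ++ y ∷ z ∷ σ → g + count true (P ρ) ≡ h + count true (V ρ) → ¬ Bad K h y z) →
  move g x + count true (P π) ≡ count true (V π) → Path K g x π
path⁺ g x [] _ _ _ eq = end (trans (sym (+-identityʳ _)) eq)
path⁺ g x (y ∷ π) ax H₁ H₂ eq =
  step ay (H₂ g [] x y π refl refl)
    (path⁺ (move g x) y π ay
      (λ { ρ z σ refl e → H₁ (y ∷ ρ) z σ refl (move-count⁺ y ρ 0 ay e) })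
      (λ { h ρ u v σ e e′ → H₂ h (x ∷ ρ) u v σ (cong (x ∷_) e) (move-count⁺ x ρ h ax e′) })
      (move-count⁻ y π 0 ay eq))
  where
  ay : move g x ≡ 0 → posE y ≡ true
  ay e = H₁ [] y π refl (trans (+-identityʳ _) e)

path⁻ : ∀ {K g x} ρ y z σ → Path K g x (ρ ++ y ∷ z ∷ σ) →
  ∃ λ h → move g x + count true (P ρ) ≡ h + count true (V ρ) × ¬ Bad K h y z
path⁻ [] y z σ (step _ _ (step _ ¬bad _)) = _ , refl , ¬bad
path⁻ (u ∷ ρ) y z σ (step allowed _ p) with h , eq , ¬bad ← path⁻ ρ y z σ p =
  h , move-count⁺ u ρ h allowed eq , ¬bad

-- The step `flatE` from height 0 to height 0 acts as a fictitious predecessor of the first step: it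
-- keeps the height and, as 0 < K, restricts nothing.
lr-path : ∀ {K w π} → 0 < K → All (1 ≤_) w → Codes (lr 0 w) π →
  (∀ g ρ x y σ → π ≡ ρ ++ x ∷ y ∷ σ → count true (P ρ) ≡ g + count true (V ρ) → ¬ Bad K g x y) → Path K 0 flatE π
lr-path {K} {w} {π} 0<K pos c ¬bad =
  path⁺ 0 flatE π (λ _ → refl)
    (λ { ρ y σ refl eq → lr-allowed ρ y σ pos c eq })
    (λ { zero [] y z σ _ _ bad → <⇒≱ 0<K (proj₁ bad)
       ; h (_ ∷ ρ) y z σ refl eq → ¬bad h ρ y z σ refl (suc-injective (trans eq (+-suc h _))) })
    (codes-balanced c)

-- Bad steps yield a k-gon

AllPairs-++⁻ : {A : Set} {R : A → A → Set} (xs : List A) {ys : List A} → AllPairs R (xs ++ ys) →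
  AllPairs R xs × AllPairs R ys × All (λ x → All (R x) ys) xs
AllPairs-++⁻ [] rs = [] , rs , []
AllPairs-++⁻ (x ∷ xs) (r ∷ rs) with rˣ , rʸ , rˣʸ ← AllPairs-++⁻ xs rs =
  Allₚ.++⁻ˡ xs r ∷ rˣ , rʸ , Allₚ.++⁻ʳ xs r ∷ rˣʸ

split-at : {A : Set} (q : ℕ) (xs : List A) → q < length xs → ∃ λ us → ∃₂ λ x vs → xs ≡ us ++ x ∷ vs × length us ≡ q
split-at zero (x ∷ xs) _ = [] , x , xs , refl , refl
split-at (suc q) (x ∷ xs) (s≤s q<) with us , y , vs , refl , refl ← split-at q xs q< = x ∷ us , y , vs , refl , refl

split-at₂ : {A : Set} (q m : ℕ) (xs : List A) → q + suc m < length xs →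
  ∃₂ λ X a → ∃₂ λ us c → ∃ λ Z → xs ≡ X ++ a ∷ us ++ c ∷ Z × length X ≡ q × length us ≡ m
split-at₂ q m xs q+m<
  with X , a , Y , refl , refl ← split-at q xs (≤-trans (s≤s (m≤m+n q (suc m))) q+m<)
  with us , c , Z , refl , refl ← split-at m Y
         (≤-pred (+-cancelˡ-< (length X) _ _ (subst (length X + suc m <_) (length-++ X) q+m<))) =
  X , a , us , c , Z , refl , refl , refl

count-pair : ∀ b c → count true (b ∷ c ∷ []) ≡ bit b + bit c
count-pair true true = refl
count-pair true false = refl
count-pair false true = refl
count-pair false false = refl

-- The witness is max(0, v - 1), the least value of q - s allowed by both lower bounds on q; the
-- inequalities of `Bad` say that it meets both upper bounds.
bad-shift : ∀ {K g p} v → K ≤ g → v + K ≤ p + g → suc K ≤ p + g → v + K ≤ suc g →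
  ∃ λ u → v ≤ suc u × u + K ≤ g × suc (u + K) ≤ p + g
bad-shift zero b₁ _ b₃ _ = 0 , z≤n , b₁ , b₃
bad-shift (suc u) _ b₂ _ b₄ = u , ≤-refl , ≤-pred b₄ , b₂

-- Here q + 1 and r + 1 are the indices of the first of the k maxima and of the k non-maxima forming a k-gon.
bad-indices : ∀ {K g s s′ t t′ p v v′} → t ≡ g + s → t + t′ ≡ s + s′ → v + v′ ≡ 2 →
  K ≤ g → v + K ≤ p + g → suc K ≤ p + g → v + K ≤ suc g →
  ∃₂ λ q δ → s ≤ q × s + v ≤ suc q × t ≡ q + K + δ × suc (q + K) ≤ t + p
    × t′ + δ + K ≤ s′ × suc (t′ + δ + K) ≤ s′ + v′
bad-indices {K} {g} {s} {s′} {t} {t′} {p} {v} {v′} refl eq v≡ b₁ b₂ b₃ b₄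
  with u , v≤ , u+K≤g , u+K<p+g ← bad-shift {p = p} v b₁ b₂ b₃ b₄
  -- δ is the number of maxima already placed beyond the first q + K. With r = t′ + δ the number of
  -- steps before the bad pair is q + K + r.
  with δ ← g ∸ (u + K) | refl ← sym (m+[n∸m]≡n u+K≤g) =
  s + u , δ , m≤m+n s u , subst (s + v ≤_) (+-suc s u) (+-monoʳ-≤ s v≤) , e₁ s u K δ ,
  subst (suc (s + u + K) ≤_) (e₂ s p (u + K + δ)) (subst (_≤ s + (p + (u + K + δ))) (e₃ s u K) (+-monoʳ-≤ s u+K<p+g)) ,
  subst (t′ + δ + K ≤_) (sym s′≡) (m≤n+m _ u) ,
  subst (λ c → suc (t′ + δ + K) ≤ c + v′) (sym s′≡)
    (subst (suc (t′ + δ + K) ≤_) (e₄ u v′ (t′ + δ + K)) (+-monoˡ-≤ (t′ + δ + K) u+v′≥1))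
  where
  e₁ : ∀ s u K δ → u + K + δ + s ≡ s + u + K + δ
  e₁ = NatSolver.solve-∀
  e₂ : ∀ s p g → s + (p + g) ≡ g + s + p
  e₂ = NatSolver.solve-∀
  e₃ : ∀ s u K → s + suc (u + K) ≡ suc (s + u + K)
  e₃ = NatSolver.solve-∀
  e₄ : ∀ u v r → u + v + r ≡ u + r + v
  e₄ = NatSolver.solve-∀
  e₅ : ∀ s u K δ t′ → u + K + δ + s + t′ ≡ s + (u + (t′ + δ + K))
  e₅ = NatSolver.solve-∀
  s′≡ : s′ ≡ u + (t′ + δ + K)
  s′≡ = +-cancelˡ-≡ s _ _ (trans (sym eq) (e₅ s u K δ t′))
  u+v′≥1 : 1 ≤ u + v′
  u+v′≥1 = ≤-pred (subst (_≤ suc (u + v′)) v≡ (+-monoˡ-≤ v′ v≤))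

entriesOf-⊆₂ : ∀ b w xs {ys zs} → entriesOf b w ≡ xs ++ ys ++ zs → ys ⊆ entries w
entriesOf-⊆₂ b w xs {ys} {zs} eq =
  ⊆-trans (⊆-++ˡ xs (⊆-++ʳ zs ⊆-refl)) (subst (_⊆ entries w) eq (entriesOf-⊆ b w))

places-disjoint : ∀ bs {x y} → x ∈ places true 1 bs → y ∈ places false 1 bs → x ≢ y
places-disjoint bs x∈ y∈ =
  All.lookup (All.lookup (proj₂ (proj₂ (AllPairs-++⁻ (places true 1 bs)
    (↭-interval⇒unique 1 (length bs) (places-↭ 1 bs))))) x∈) y∈

sorted-chain : ∀ L U lo hi → AllPairs _<_ L → All (0 <_) L → AllPairs _<_ U → 0 < lo →
  All (_< lo) L → lo < hi → All (hi <_) U → AllPairs _<_ (0 ∷ L ++ lo ∷ hi ∷ U)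
sorted-chain L U lo hi L< 0<L U< 0<lo L<lo lo<hi hi<U =
  Allₚ.++⁺ 0<L (0<lo ∷ 0<hi ∷ All.map (<-trans 0<hi) hi<U)
  ∷ AllPairsₚ.++⁺ L< ((lo<hi ∷ All.map (<-trans lo<hi) hi<U) ∷ hi<U ∷ U<)
      (All.map (λ x<lo → x<lo ∷ <-trans x<lo lo<hi ∷ All.map (<-trans (<-trans x<lo lo<hi)) hi<U) L<lo)
  where
  0<hi : 0 < hi
  0<hi = ≤-<-trans z≤n lo<hi

split-exact : {A : Set} (xs : List A) {ys us vs : List A} → xs ++ ys ≡ us ++ vs → length xs ≡ length us → xs ≡ us × ys ≡ vs
split-exact [] {us = []} eq _ = refl , eq
split-exact (x ∷ xs) {us = _ ∷ us} eq len
  with refl , eq′ ← ∷-injective eq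
  with refl , eq″ ← split-exact xs {us = us} eq′ (suc-injective len) = refl , eq″

module _ (b : Bool) (u v : List (Bool × ℕ)) (X Y : List ℕ) {Z : List ℕ} (eq : entriesOf b (u ++ v) ≡ X ++ Y ++ Z) where

  private
    eq′ : entriesOf b u ++ entriesOf b v ≡ X ++ Y ++ Z
    eq′ = trans (sym (entriesOf-++ b u v)) eq

  chunk-before : length X + length Y ≤ length (entriesOf b u) → Y ⊆ entries u
  chunk-before len with zs , e , _ ← prefix-split (X ++ Y) (trans (++-assoc X Y Z) (sym eq′))
                                       (subst (_≤ length (entriesOf b u)) (sym (length-++ X)) len) =
    entriesOf-⊆₂ b u X (trans e (++-assoc X Y zs))

  chunk-after : length (entriesOf b u) ≤ length X → Y ⊆ entries v
  chunk-after len with zs , _ , e ← prefix-split (entriesOf b u) {us = X} eq′ len = entriesOf-⊆₂ b v zs e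

blocks-++ : ∀ {A : Set} (a : A) us x y ls b → (a ∷ us ++ x ∷ []) ++ (y ∷ ls ++ b ∷ []) ≡ blocks a us x y ls b
blocks-++ a us x y ls b = cong (a ∷_) (++-assoc us (x ∷ []) _)

-- If δ > 0, all k maxima lie in u and all k non-maxima after it. If δ = 0, then c is the next
-- maximum after u and d the next non-maximum. At least one of the two entries following u is a
-- maximum, so their labels decide whether c or d comes first.
gon-positions : ∀ {lx x₀ ly y₀} u v δ X a us c Z X′ d ls b Z′ → (let w = u ++ (lx , x₀) ∷ (ly , y₀) ∷ v) →
  entriesOf true w ≡ X ++ a ∷ us ++ c ∷ Z → entriesOf false w ≡ X′ ++ d ∷ ls ++ b ∷ Z′ →
  length (entriesOf true u) ≡ length X + suc (length us) + δ → length (entriesOf false u) + δ ≡ length X′ →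
  1 ≤ δ + (bit lx + bit ly) →
  ∃ λ i → blocks a us (pick i d c) (pick i c d) ls b ⊆ entries w
gon-positions {lx} {x₀} {ly} {y₀} u v (suc δ) X a us c Z X′ d ls b Z′ eqE eqD lenE lenD _ = false ,
  subst₂ _⊆_ (blocks-++ a us c d ls b) (sym (map-++ proj₂ u _))
    (⊆-++⁺
      (chunk-before true u _ X (a ∷ us ++ c ∷ []) (trans eqE (cong (λ l → X ++ a ∷ l) (sym (++-assoc us (c ∷ []) Z))))
        (subst₂ _≤_ (cong (λ l → length X + suc l) (sym (trans (length-++ us) (+-comm (length us) 1)))) (sym lenE)
          (subst (_≤ length X + suc (length us) + suc δ) (sym (+-suc (length X) (suc (length us))))
            (subst (suc (length X + suc (length us)) ≤_) (sym (+-suc _ δ)) (s≤s (m≤m+n _ δ))))))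
      (chunk-after false u _ X′ (d ∷ ls ++ b ∷ []) (trans eqD (cong (λ l → X′ ++ d ∷ l) (sym (++-assoc ls (b ∷ []) Z′))))
        (subst (length (entriesOf false u) ≤_) lenD (m≤m+n _ (suc δ)))))
gon-positions {lx} {x₀} {ly} {y₀} u v zero X a us c Z X′ d ls b Z′ eqE eqD lenE lenD pos =
  proj₁ tail , subst (blocks a us (pick (proj₁ tail) d c) (pick (proj₁ tail) c d) ls b ⊆_) (sym (map-++ proj₂ u _)) (⊆-++⁺ head (proj₂ tail))
  where
  lenE′ : length (entriesOf true u) ≡ length (X ++ a ∷ us)
  lenE′ = trans lenE (trans (+-identityʳ _) (sym (length-++ X)))
  head : a ∷ us ⊆ entries u
  head = chunk-before true u _ X (a ∷ us) eqE (≤-reflexive (trans (sym (length-++ X)) (sym lenE′)))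
  restE : entriesOf true ((lx , x₀) ∷ (ly , y₀) ∷ v) ≡ c ∷ Z
  restE = proj₂ (split-exact (entriesOf true u) (trans (sym (entriesOf-++ true u _)) (trans eqE (sym (++-assoc X (a ∷ us) (c ∷ Z))))) lenE′)
  restD : entriesOf false ((lx , x₀) ∷ (ly , y₀) ∷ v) ≡ d ∷ ls ++ b ∷ Z′
  restD = proj₂ (split-exact (entriesOf false u) (trans (sym (entriesOf-++ false u _)) eqD) (trans (sym (+-identityʳ _)) lenD))
  others : ∀ {xs} → entriesOf false v ≡ xs ++ b ∷ Z′ → xs ++ b ∷ [] ⊆ entries v
  others {xs} eq = entriesOf-⊆₂ false v [] (trans eq (sym (++-assoc xs (b ∷ []) Z′)))
  go : ∀ lx ly → 1 ≤ bit lx + bit ly → entriesOf true ((lx , x₀) ∷ (ly , y₀) ∷ v) ≡ c ∷ Z →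
    entriesOf false ((lx , x₀) ∷ (ly , y₀) ∷ v) ≡ d ∷ ls ++ b ∷ Z′ →
    ∃ λ i → pick i d c ∷ pick i c d ∷ ls ++ b ∷ [] ⊆ x₀ ∷ y₀ ∷ entries v
  go true true _ e₁ e₂ with refl ← ∷-injectiveˡ e₁ = false , refl ∷ (y₀ Sublist.∷ʳ others {d ∷ ls} e₂)
  go true false _ e₁ e₂ with refl ← ∷-injectiveˡ e₁ | refl ← ∷-injectiveˡ e₂ = false , refl ∷ refl ∷ others (∷-injectiveʳ e₂)
  go false true _ e₁ e₂ with refl ← ∷-injectiveˡ e₁ | refl ← ∷-injectiveˡ e₂ = true , refl ∷ refl ∷ others (∷-injectiveʳ e₂)
  tail : ∃ λ i → pick i d c ∷ pick i c d ∷ ls ++ b ∷ [] ⊆ x₀ ∷ y₀ ∷ entries v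
  tail = go lx ly pos restE restD

-- The cut at i separates L from a, the cut at j separates b from the remaining maxima, and
-- sortedness gives the other comparisons except a with b. That one selects the pattern.
gon-values : ∀ {m i j} L us c a b → i ≤ j → length us ≡ m → length L ≡ suc m → AllPairs _<_ L → All (0 <_) L → AllPairs _<_ (a ∷ us ++ c ∷ []) →
  All (_≤ i) L → i < a → b ≤ j → All (j <_) (us ++ c ∷ []) → All (_< b) L → 0 < b → a ≢ b → ∀ e →
  ∃ λ h → ∃₂ λ d ls → L ≡ d ∷ ls × T (orderIso (blocks a us (pick e d c) (pick e c d) ls b) (gon m h e))
gon-values {j = j} (d ∷ ls) us c a b i≤j |us| |L| L< 0<L (a< ∷ U<) L≤i i<a b≤j j<U L<b 0<b a≢b e with <-cmp a b
... | tri< a<b _ _ = true , d , ls , refl ,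
  gon-orderIso d ls a b us c (suc-injective |L|) |us|
    (sorted-chain (d ∷ ls) (us ++ c ∷ []) a b L< 0<L U< (≤-<-trans z≤n i<a) (All.map (λ x≤i → ≤-<-trans x≤i i<a) L≤i) a<b
      (All.map (≤-<-trans b≤j) j<U)) true e
... | tri≈ _ a≡b _ = contradiction a≡b a≢b
... | tri> _ _ b<a = false , d , ls , refl ,
  gon-orderIso d ls b a us c (suc-injective |L|) |us|
    (sorted-chain (d ∷ ls) (us ++ c ∷ []) b a L< 0<L U< 0<b L<b b<a a<) false e

two-maxima : ∀ lx x₀ ly y₀ v → bit lx + bit ly ≤ length (entriesOf true ((lx , x₀) ∷ (ly , y₀) ∷ v))
two-maxima true _ true _ _ = s≤s (s≤s z≤n)
two-maxima true _ false _ _ = s≤s z≤n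
two-maxima false _ true _ _ = s≤s z≤n
two-maxima false _ false _ _ = z≤n

module _ {m : ℕ} (A B R : List Bool) (u v : List (Bool × ℕ)) (lx ly : Bool) (x₀ y₀ δ : ℕ)
  (eq : ∀ b → entriesOf b (u ++ (lx , x₀) ∷ (ly , y₀) ∷ v) ≡ places b 1 ((A ++ B) ++ R)) where

  private
    w : List (Bool × ℕ)
    w = u ++ (lx , x₀) ∷ (ly , y₀) ∷ v

    bs : List Bool
    bs = (A ++ B) ++ R

    sorted : ∀ b → AllPairs _<_ (places b 1 bs)
    sorted b = places-sorted b 1 bs

    split : ∀ b → places b 1 (A ++ B ++ R) ≡ places b 1 bs
    split b = cong (places b 1) (sym (++-assoc A B R))

    boundE : length (entriesOf true u) + (bit lx + bit ly) ≤ length (places true 1 bs)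
    boundE = subst (length (entriesOf true u) + (bit lx + bit ly) ≤_)
      (trans (sym (length-++ (entriesOf true u))) (cong length (trans (sym (entriesOf-++ true u _)) (eq true))))
      (+-monoʳ-≤ (length (entriesOf true u)) (two-maxima lx x₀ ly y₀ v))

    boundD : count false (A ++ B) ≤ length (places false 1 bs)
    boundD = subst (count false (A ++ B) ≤_) (sym (trans (length-places false 1 bs) (count-++ false (A ++ B) R))) (m≤m+n _ _)

  -- The values are cut after A and after `A ++ B`. The bounds on maxima put a above the first cut
  -- and `us`, c above the second; those on non-maxima put d, `ls` below the first and b below the
  -- second.
  chains⇒gon : ∀ X a us c Z X′ d ls b Z′ →
    places true 1 bs ≡ X ++ a ∷ us ++ c ∷ Z → places false 1 bs ≡ X′ ++ d ∷ ls ++ b ∷ Z′ →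
    length us ≡ m → length ls ≡ m →
    count true A ≤ length X → count true (A ++ B) ≤ suc (length X) →
    length X′ + suc m ≤ count false A → suc (length X′ + suc m) ≤ count false (A ++ B) →
    length (entriesOf true u) ≡ length X + suc m + δ → length (entriesOf false u) + δ ≡ length X′ →
    1 ≤ δ + (bit lx + bit ly) →
    ∃₂ λ h e → Contains (entries w) (gon m h e)
  chains⇒gon X a us c Z X′ d ls b Z′ eqE eqD refl |ls| a₁ a₂ b₁ b₂ lenE lenD pos
    with _ , sE , _ ← AllPairs-++⁻ X (subst (AllPairs _<_) eqE (sorted true))
    with _ , sD , _ ← AllPairs-++⁻ X′ (subst (AllPairs _<_) eqD (sorted false))
    with sE′ , _ , _ ← AllPairs-++⁻ (a ∷ us ++ c ∷ []) {Z} (subst (AllPairs _<_) (cong (a ∷_) (sym (++-assoc us (c ∷ []) Z))) sE)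
    with sL , _ , L<bZ ← AllPairs-++⁻ (d ∷ ls) {b ∷ Z′} sD
    with e , sub ← gon-positions u v δ X a us c Z X′ d ls b Z′ (trans (eq true) eqE) (trans (eq false) eqD) lenE lenD pos
    with 1≤D ← Allₚ.++⁻ʳ X′ (subst (All (1 ≤_)) eqD (places-≥ false 1 bs))
    with h , _ , _ , refl , iso ← gon-values {length us} {length A} {length (A ++ B)} (d ∷ ls) us c a b
           (subst (length A ≤_) (sym (length-++ A)) (m≤m+n (length A) (length B))) refl (cong suc |ls|) sL
           (Allₚ.++⁻ˡ (d ∷ ls) 1≤D) sE′
           (Allₚ.++⁻ʳ X′ (early-places false A (B ++ R) {X′ ++ d ∷ ls} (trans (split false) (trans eqD (sym (++-assoc X′ (d ∷ ls) (b ∷ Z′)))))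
             (subst (_≤ count false A) (sym (trans (length-++ X′) (cong (λ l → length X′ + suc l) |ls|))) b₁)))
           (All.head (late-places true A (B ++ R) {X} (trans (split true) eqE) a₁))
           (All.head (Allₚ.++⁻ʳ (X′ ++ d ∷ ls) (early-places false (A ++ B) R {(X′ ++ d ∷ ls) ++ b ∷ []}
             (trans eqD (trans (sym (++-assoc X′ (d ∷ ls) (b ∷ Z′))) (sym (++-assoc (X′ ++ d ∷ ls) (b ∷ []) Z′))))
             (subst (_≤ count false (A ++ B)) (sym (trans (length-++ (X′ ++ d ∷ ls)) (trans (+-comm _ 1)
               (cong suc (trans (length-++ X′) (cong (λ l → length X′ + suc l) |ls|)))))) b₂))))
           (Allₚ.++⁻ˡ (us ++ c ∷ []) (subst (All (length (A ++ B) <_)) (sym (++-assoc us (c ∷ []) Z))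
             (late-places true (A ++ B) R {X ++ a ∷ []} (trans eqE (sym (++-assoc X (a ∷ []) (us ++ c ∷ Z))))
               (subst (count true (A ++ B) ≤_) (sym (trans (length-++ X) (+-comm (length X) 1))) a₂))))
           (All.map All.head L<bZ)
           (All.head (Allₚ.++⁻ʳ (d ∷ ls) 1≤D))
           (places-disjoint bs (subst (a ∈_) (sym eqE) (∈-++⁺ʳ X (here refl)))
             (subst (b ∈_) (sym eqD) (∈-++⁺ʳ X′ (∈-++⁺ʳ (d ∷ ls) (here refl)))))
           e
    = h , e , _ , sub , iso

  indices⇒gon : ∀ q r → count true A ≤ q → count true (A ++ B) ≤ suc q →
    r + suc m ≤ count false A → suc (r + suc m) ≤ count false (A ++ B) →
    length (entriesOf true u) ≡ q + suc m + δ → length (entriesOf false u) + δ ≡ r →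
    suc (q + suc m) ≤ length (entriesOf true u) + (bit lx + bit ly) →
    ∃₂ λ h e → Contains (entries w) (gon m h e)
  indices⇒gon q r a₁ a₂ b₁ b₂ lenE lenD pos
    with X , a , us , c , Z , eqE , refl , |us| ← split-at₂ q m (places true 1 bs) (≤-trans pos boundE)
    with X′ , d , ls , b , Z′ , eqD , refl , |ls| ← split-at₂ r m (places false 1 bs) (≤-trans b₂ boundD) =
    chains⇒gon X a us c Z X′ d ls b Z′ eqE eqD |us| |ls| a₁ a₂ b₁ b₂ lenE lenD
      (+-cancelˡ-≤ (length X + suc m) 1 _ (subst₂ _≤_ (+-comm 1 _) (trans (cong (_+ (bit lx + bit ly)) lenE) (+-assoc (length X + suc m) δ _)) pos))

bad⇒gon : ∀ {w m g} ρ x y σ → Codes w (ρ ++ x ∷ y ∷ σ) → count true (P ρ) ≡ g + count true (V ρ) →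
  Bad (suc m) g x y → ∃₂ λ h e → Contains (entries w) (gon m h e)
bad⇒gon {w} {m} {g} ρ x y σ c eq (b₁ , b₂ , b₃ , b₄)
  with q , δ , s≤q , s+v≤q+1 , t≡ , q+K< , r+K≤s′ , r+K+1≤s′+v′ ←
         bad-indices {suc m} {g} {count true (V ρ)} {count false (V ρ)} {count true (P ρ)} {count false (P ρ)}
           {bit (posE x) + bit (posE y)} {bit (valE x) + bit (valE y)} {count false (valE x ∷ valE y ∷ [])} eq
           (trans (count-total (P ρ)) (trans (trans (length-P ρ) (sym (length-V ρ))) (sym (count-total (V ρ)))))
           (trans (cong (_+ count false (valE x ∷ valE y ∷ [])) (sym (count-pair (valE x) (valE y)))) (count-total (valE x ∷ valE y ∷ [])))
           b₁ b₂ b₃ b₄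
  = result (codes-at ρ (x ∷ y ∷ σ) c)
  where
  Vxy = valE x ∷ valE y ∷ []
  two-entries : ∀ v {b c bs} → labels v ≡ b ∷ c ∷ bs → ∃₂ λ x₀ y₀ → ∃ λ v′ → v ≡ (b , x₀) ∷ (c , y₀) ∷ v′
  two-entries ((_ , x₀) ∷ (_ , y₀) ∷ v) refl = x₀ , y₀ , v , refl
  result : CodesAt w ρ (x ∷ y ∷ σ) → ∃₂ λ h e → Contains (entries w) (gon m h e)
  result record { before = u ; after = after ; w≡ = refl ; labels-after = eqʳ ; length-before = len }
    with x₀ , y₀ , v , refl ← two-entries after eqʳ =
    indices⇒gon (V ρ) Vxy (V σ) u v (posE x) (posE y) x₀ y₀ δ
      (λ b → trans (Codes.codes-entries c b)
        (cong (places b 1) (trans (map-++ valE ρ (x ∷ y ∷ σ)) (sym (++-assoc (V ρ) Vxy (V σ))))))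
      q (count false (P ρ) + δ) s≤q
      (subst (_≤ suc q) (sym (trans (count-++ true (V ρ) Vxy) (cong (λ n → count true (V ρ) + n) (count-pair (valE x) (valE y))))) s+v≤q+1)
      r+K≤s′ (subst (suc (count false (P ρ) + δ + suc m) ≤_) (sym (count-++ false (V ρ) Vxy)) r+K+1≤s′+v′)
      (trans (len true) t≡) (cong (_+ δ) (len false))
      (subst (λ t → suc (q + suc m) ≤ t + (bit (posE x) + bit (posE y))) (sym (len true)) q+K<)

-- A k-gon yields bad steps

⊆-++⁻ : {A : Set} (xs : List A) {ys zs : List A} → xs ++ ys ⊆ zs → ∃₂ λ us vs → zs ≡ us ++ vs × xs ⊆ us × ys ⊆ vs
⊆-++⁻ [] {zs = zs} p = [] , zs , refl , [] , p
⊆-++⁻ (x ∷ xs) (y Sublist.∷ʳ p) with us , vs , refl , q , q′ ← ⊆-++⁻ (x ∷ xs) p = y ∷ us , vs , refl , y Sublist.∷ʳ q , q′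
⊆-++⁻ (x ∷ xs) (refl ∷ p) with us , vs , refl , q , q′ ← ⊆-++⁻ xs p = x ∷ us , vs , refl , refl ∷ q , q′

⊆-skipˡ : {Q : ℕ → Set} {xs : List ℕ} (ys : List ℕ) {zs : List ℕ} → xs ⊆ ys ++ zs → All Q xs → All (¬_ ∘ Q) ys → length xs ≤ length zs
⊆-skipˡ [] p _ _ = length-mono-≤ p
⊆-skipˡ (y ∷ ys) (_ Sublist.∷ʳ p) q (_ ∷ n) = ⊆-skipˡ ys p q n
⊆-skipˡ (y ∷ ys) (refl ∷ p) (qy ∷ _) (¬qy ∷ _) = contradiction qy ¬qy

⊆-skipʳ : {Q : ℕ → Set} {xs : List ℕ} (ys : List ℕ) {zs : List ℕ} → xs ⊆ ys ++ zs → All Q xs → All (¬_ ∘ Q) zs → length xs ≤ length ys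
⊆-skipʳ [] [] _ _ = z≤n
⊆-skipʳ [] (_ Sublist.∷ʳ p) q (_ ∷ n) = ⊆-skipʳ [] p q n
⊆-skipʳ [] (refl ∷ p) (qz ∷ _) (¬qz ∷ _) = contradiction qz ¬qz
⊆-skipʳ (y ∷ ys) (_ Sublist.∷ʳ p) q n = m≤n⇒m≤1+n (⊆-skipʳ ys p q n)
⊆-skipʳ (y ∷ ys) (refl ∷ p) (_ ∷ q) n = s≤s (⊆-skipʳ ys p q n)

Marked : Bool → (ℕ → Set) → Bool × ℕ → Set
Marked b Q (c , x) = c ≡ b × Q x

marked-⊆ : ∀ {b Q xs w} → xs ⊆ w → All (Marked b Q) xs → entries xs ⊆ entriesOf b w × All Q (entries xs)
marked-⊆ {true} [] [] = [] , []
marked-⊆ {false} [] [] = [] , []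
marked-⊆ {true} ((true , _) Sublist.∷ʳ p) a = _ Sublist.∷ʳ proj₁ (marked-⊆ p a) , proj₂ (marked-⊆ p a)
marked-⊆ {true} ((false , _) Sublist.∷ʳ p) a = marked-⊆ p a
marked-⊆ {false} ((true , _) Sublist.∷ʳ p) a = marked-⊆ p a
marked-⊆ {false} ((false , _) Sublist.∷ʳ p) a = _ Sublist.∷ʳ proj₁ (marked-⊆ p a) , proj₂ (marked-⊆ p a)
marked-⊆ {true} (refl ∷ p) ((refl , q) ∷ a) = refl ∷ proj₁ (marked-⊆ p a) , q ∷ proj₂ (marked-⊆ p a)
marked-⊆ {false} (refl ∷ p) ((refl , q) ∷ a) = refl ∷ proj₁ (marked-⊆ p a) , q ∷ proj₂ (marked-⊆ p a)

places-drop : ∀ b i s bs → All (i + s ≤_) (places b (length (take i bs) + s) (drop i bs))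
places-drop b zero s bs = places-≥ b s bs
places-drop true (suc i) s [] = []
places-drop false (suc i) s [] = []
places-drop b (suc i) s (c ∷ bs) =
  subst₂ (λ l j → All (l ≤_) (places b j (drop i bs))) (+-suc i s) (+-suc (length (take i bs)) s) (places-drop b i (suc s) bs)

places-take : ∀ b i s bs → All (_< i + s) (places b s (take i bs))
places-take b i s bs = All.map (λ x< → <-≤-trans x< (+-monoˡ-≤ s (subst (_≤ i) (sym (length-take i bs)) (m⊓n≤m i (length bs)))))
  (places-< b s (take i bs))

module _ {bs : List Bool} (u v : List (Bool × ℕ)) (eq : ∀ b → entriesOf b (u ++ v) ≡ places b 1 bs) (i : ℕ) where

  private
    early late : Bool → List ℕ
    early b = places b 1 (take i bs)
    late b = places b (length (take i bs) + 1) (drop i bs)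

    early≤ : ∀ b → All (_≤ i) (early b)
    early≤ b = All.map (λ {x} x< → ≤-pred (subst (x <_) (+-comm i 1) x<)) (places-take b i 1 bs)

    late> : ∀ b → All (i <_) (late b)
    late> b = subst (λ j → All (j ≤_) (late b)) (+-comm i 1) (places-drop b i 1 bs)

    split : ∀ b → entriesOf b u ++ entriesOf b v ≡ early b ++ late b
    split b = trans (sym (entriesOf-++ b u v)) (trans (eq b)
      (trans (cong (places b 1) (sym (take++drop≡id i bs))) (places-++ b 1 (take i bs) (drop i bs))))

  -- Entries with one label increase from left to right, so if u contains one above i, it contains
  -- all those up to i. This needs at least one such entry, hence the form `x ∷ xs`.
  many-before : ∀ b {x xs} → x ∷ xs ⊆ u → All (Marked b (i <_)) (x ∷ xs) →
    count b (take i bs) + suc (length xs) ≤ length (entriesOf b u)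
  many-before b {x} {xs} p a with p′ , a′ ← marked-⊆ p a with ≤-total (length (entriesOf b u)) (length (early b))
  ... | inj₁ le with zs , e , _ ← prefix-split (entriesOf b u) (split b) le =
    contradiction (All.head a′) (≤⇒≯ (All.head (All-resp-⊆ p′ (Allₚ.++⁻ˡ (entriesOf b u) (subst (All (_≤ i)) e (early≤ b))))))
  ... | inj₂ ge with zs , e , _ ← prefix-split (early b) (sym (split b)) ge =
    subst₂ _≤_ (cong (_+ suc (length xs)) (length-places b 1 (take i bs))) (trans (sym (length-++ (early b))) (cong length (sym e)))
      (+-monoʳ-≤ (length (early b)) (subst (_≤ length zs) (length-map proj₂ (x ∷ xs))
        (⊆-skipˡ (early b) (subst (entries (x ∷ xs) ⊆_) e p′) a′ (All.map ≤⇒≯ (early≤ b)))))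

  -- Dually, an entry up to i in v forces all entries of u with the same label to be at most i.
  many-after : ∀ b {x xs} → x ∷ xs ⊆ v → All (Marked b (_≤ i)) (x ∷ xs) →
    length (entriesOf b u) + suc (length xs) ≤ count b (take i bs)
  many-after b {x} {xs} p a with p′ , a′ ← marked-⊆ p a with ≤-total (length (entriesOf b u)) (length (early b))
  ... | inj₁ le with zs , e , e′ ← prefix-split (entriesOf b u) (split b) le =
    subst (length (entriesOf b u) + suc (length xs) ≤_) (trans (sym (length-++ (entriesOf b u))) (trans (cong length (sym e)) (length-places b 1 (take i bs))))
      (+-monoʳ-≤ (length (entriesOf b u)) (subst (_≤ length zs) (length-map proj₂ (x ∷ xs))
        (⊆-skipʳ zs (subst (entries (x ∷ xs) ⊆_) e′ p′) a′ (All.map <⇒≱ (late> b)))))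
  ... | inj₂ ge with zs , _ , e ← prefix-split (early b) (sym (split b)) ge =
    contradiction (All.head a′) (<⇒≱ (All.head (All-resp-⊆ p′ (Allₚ.++⁻ʳ zs (subst (All (i <_)) e (late> b))))))

count-not : ∀ b bs → count b bs + count (not b) bs ≡ length bs
count-not true bs = count-total bs
count-not false bs = trans (+-comm (count false bs) (count true bs)) (count-total bs)

-- Read as a lattice path, a word passing on one side of the point (a, r) is still on that side
-- where it crosses the antidiagonal of (a, r).
prefix-count : ∀ b {a r} us {vs} xs {ys} → us ++ vs ≡ xs ++ ys → a ≤ count b us → count (not b) us ≤ r →
  length xs ≡ a + r → a ≤ count b xs
prefix-count b {a} {r} us xs eq a≤ ≤r len with ≤-total (length us) (length xs)
... | inj₁ le with zs , refl , _ ← prefix-split us {us = xs} eq le = ≤-trans a≤ (subst (count b us ≤_) (sym (count-++ b us zs)) (m≤m+n _ _))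
... | inj₂ ge with zs , refl , _ ← prefix-split xs {us = us} (sym eq) ge =
  +-cancelʳ-≤ r a _ (subst (_≤ count b xs + r) (trans (count-not b xs) len) (+-monoʳ-≤ (count b xs)
    (≤-trans (subst (count (not b) xs ≤_) (sym (count-++ (not b) xs zs)) (m≤m+n _ _)) ≤r)))

-- The witness is max(a, b - 1); the hypotheses compare each lower bound on q with each upper bound.
between : ∀ {a b c d m} → a + suc m ≤ c → b + m ≤ c → suc (a + suc m) ≤ d → b + suc m ≤ d →
  ∃ λ q → a ≤ q × b ≤ suc q × q + suc m ≤ c × suc (q + suc m) ≤ d
between {a} {b} {c} {d} {m} h₁ h₂ h₃ h₄ with <-cmp′ a b
  where
  <-cmp′ : ∀ a b → b ≤ suc a ⊎ ∃ λ q → b ≡ suc q × a ≤ q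
  <-cmp′ a zero = inj₁ z≤n
  <-cmp′ a (suc q) with ≤-total q a
  ... | inj₁ q≤a = inj₁ (s≤s q≤a)
  ... | inj₂ a≤q = inj₂ (q , refl , a≤q)
... | inj₁ b≤ = a , ≤-refl , b≤ , h₁ , h₃
... | inj₂ (q , refl , a≤q) = q , a≤q , ≤-refl , subst (_≤ c) (sym (+-suc q m)) h₂ , h₄

-- Elimination of q: each inequality of `Bad` combines one of its two lower bounds with one of its
-- two upper bounds.
bad-intro : ∀ {K q h s t p v} → t ≡ h + s → s ≤ q → s + v ≤ suc q → q + K ≤ t → suc (q + K) ≤ t + p →
  K ≤ h × v + K ≤ p + h × suc K ≤ p + h × v + K ≤ suc h
bad-intro {K} {q} {h} {s} {t} {p} {v} refl s≤q s+v≤ q+K≤ q+K< =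
  +-cancelˡ-≤ s K h (≤-trans (+-monoˡ-≤ K s≤q) (subst (q + K ≤_) (+-comm h s) q+K≤)) ,
  +-cancelˡ-≤ s (v + K) (p + h) (≤-trans (subst (_≤ suc (q + K)) (+-assoc s v K) (+-monoˡ-≤ K s+v≤)) (subst (suc (q + K) ≤_) (e₁ h s p) q+K<)) ,
  +-cancelˡ-≤ s (suc K) (p + h) (≤-trans (subst (_≤ suc (q + K)) (sym (+-suc s K)) (s≤s (+-monoˡ-≤ K s≤q))) (subst (suc (q + K) ≤_) (e₁ h s p) q+K<)) ,
  +-cancelˡ-≤ s (v + K) (suc h) (≤-trans (subst (_≤ suc (q + K)) (+-assoc s v K) (+-monoˡ-≤ K s+v≤)) (subst (suc (q + K) ≤_) (e₂ h s) (s≤s q+K≤)))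
  where
  e₁ : ∀ h s p → h + s + p ≡ s + (p + h)
  e₁ = NatSolver.solve-∀
  e₂ : ∀ h s → suc (h + s) ≡ s + suc h
  e₂ = NatSolver.solve-∀

Threshold : ℕ → ℕ → List (ℕ × ℕ) → Set
Threshold c v xs = All (λ { (x , t) → (t ≤ c → x ≤ v) × (c < t → v < x) }) xs

-- The threshold is the largest entry of pattern value at most c.
threshold-least : ∀ c xs → AllPairs SameOrder xs → All (λ p → 0 < proj₁ p) xs →
  ∃ λ v → Threshold c v xs × (∀ y → 0 < y → All (λ { (x , t) → t ≤ c → x < y }) xs → v < y)
threshold-least c [] _ _ = 0 , [] , λ y 0<y _ → 0<y
threshold-least c ((x , t) ∷ xs) (sx ∷ same) (0<x ∷ pos) with v , th , least ← threshold-least c xs same pos with t ≤? c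
... | yes t≤c = v ⊔ x ,
  ((λ _ → m≤n⊔m v x) , (λ c<t → contradiction c<t (≤⇒≯ t≤c)))
    ∷ All.zipWith (λ { {(y , u)} ((y≤ , <y) , (t<u⇒ , _)) → (λ u≤c → ≤-trans (y≤ u≤c) (m≤m⊔n v x)) ,
                       (λ c<u → ⊔-lub (<y c<u) (t<u⇒ (≤-<-trans t≤c c<u))) }) (th , sx) ,
  λ { y 0<y (x<y ∷ a) → ⊔-lub (least y 0<y a) (x<y t≤c) }
-- All entries of pattern value at most c lie below x, so v < x because v is least.
... | no t≰c = v ,
  ((λ t≤c → contradiction t≤c t≰c) , (λ _ → least x 0<x (All.map (λ { {(y , u)} (_ , u<t⇒) u≤c → u<t⇒ (≤-<-trans u≤c (≰⇒> t≰c)) }) sx))) ∷ th ,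
  λ { y 0<y (_ ∷ a) → least y 0<y a }

count-prefix : ∀ b {xs ys zs} → zs ≡ xs ++ ys → count b xs ≤ count b zs
count-prefix b {xs} {ys} refl = subst (count b xs ≤_) (sym (count-++ b xs ys)) (m≤m+n _ _)

-- The cuts of positions and of values are arbitrary. The bounds yield q from the maxima and r from
-- the non-maxima, and `prefix-count` moves the cuts to the lengths q + K + r and q + K + r + 2,
-- where they surround a bad pair of steps.
crossing : ∀ {m π p₁ r₁ p₂ r₂ v₁ s₁ v₂ s₂} → Path (suc m) 0 flatE π →
  P π ≡ p₁ ++ r₁ → P π ≡ p₂ ++ r₂ → V π ≡ v₁ ++ s₁ → V π ≡ v₂ ++ s₂ →
  count true v₁ + suc m ≤ count true p₁ → count true v₂ + m ≤ count true p₁ →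
  suc (count true v₁ + suc m) ≤ count true p₂ → count true v₂ + suc m ≤ count true p₂ →
  count false p₁ + suc m ≤ count false v₁ → count false p₂ + m ≤ count false v₁ →
  suc (count false p₁ + suc m) ≤ count false v₂ → count false p₂ + suc m ≤ count false v₂ → ⊥
crossing {m} {π} {p₁} {_} {p₂} {_} {v₁} {_} {v₂} path eqp₁ eqp₂ eqv₁ eqv₂ a₁ a₂ a₃ a₄ b₁ b₂ b₃ b₄
  with q , v₁≤q , v₂≤q , q≤p₁ , q<p₂ ← between a₁ a₂ a₃ a₄
  with r , p₁≤r , p₂≤r , r≤v₁ , r<v₂ ← between b₁ b₂ b₃ b₄
  = contra (split-at (q + suc m + r) π (<⇒≤ long))
  where
  balanced : count true (P π) ≡ count true (V π)
  balanced = motzkin-count (path⇒motzkin path)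
  -- There are at least q + K + 1 maxima and r + K + 1 non-maxima in all, which leaves room for two
  -- steps after the first q + K + r.
  long : suc (suc (q + suc m + r)) ≤ length π
  long = ≤-trans (s≤s (≤-trans (≤-reflexive (sym (+-suc (q + suc m) r))) (+-monoʳ-≤ (q + suc m) (s≤s (m≤m+n r (suc m))))))
    (subst (suc (q + suc m) + suc (r + suc m) ≤_) (trans (count-total (P π)) (length-P π))
      (+-mono-≤ (≤-trans q<p₂ (count-prefix true {p₂} eqp₂))
        (≤-trans r<v₂ (≤-trans (count-prefix false {v₂} eqv₂) (≤-reflexive (sym (balance π balanced)))))))
  contra : (∃ λ ρ → ∃₂ λ x τ → π ≡ ρ ++ x ∷ τ × length ρ ≡ q + suc m + r) → ⊥
  contra (ρ , x , [] , refl , len) = 1+n≰n (≤-trans long (≤-reflexive (trans (length-++ ρ) (trans (+-comm (length ρ) 1) (cong suc len)))))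
  contra (ρ , x , y ∷ σ , refl , len) with h , eq , ¬bad ← path⁻ ρ x y σ path =
    ¬bad (bad-intro {suc m} {q} {h} {count true (V ρ)} {count true (P ρ)} {bit (posE x) + bit (posE y)} {bit (valE x) + bit (valE y)}
      eq sρ≤ sρ₂≤ tρ≥ tρ₂≥)
    where
    Pxy = posE x ∷ posE y ∷ []
    Vxy = valE x ∷ valE y ∷ []
    P≡ : P (ρ ++ x ∷ y ∷ σ) ≡ P ρ ++ P (x ∷ y ∷ σ)
    P≡ = map-++ posE ρ (x ∷ y ∷ σ)
    V≡ : V (ρ ++ x ∷ y ∷ σ) ≡ V ρ ++ V (x ∷ y ∷ σ)
    V≡ = map-++ valE ρ (x ∷ y ∷ σ)
    P≡₂ : P (ρ ++ x ∷ y ∷ σ) ≡ (P ρ ++ Pxy) ++ P σ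
    P≡₂ = trans P≡ (sym (++-assoc (P ρ) Pxy (P σ)))
    V≡₂ : V (ρ ++ x ∷ y ∷ σ) ≡ (V ρ ++ Vxy) ++ V σ
    V≡₂ = trans V≡ (sym (++-assoc (V ρ) Vxy (V σ)))
    lenP : length (P ρ) ≡ q + suc m + r
    lenP = trans (length-P ρ) len
    lenV : length (V ρ) ≡ r + suc m + q
    lenV = trans (length-V ρ) (trans len (flip q (suc m) r))
      where
      flip : ∀ q k r → q + k + r ≡ r + k + q
      flip = NatSolver.solve-∀
    lenP₂ : length (P ρ ++ Pxy) ≡ suc (q + suc m) + suc r
    lenP₂ = trans (length-++ (P ρ)) (trans (cong (_+ 2) lenP) (shift₂ (q + suc m) r))
      where
      shift₂ : ∀ a r → a + r + 2 ≡ suc a + suc r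
      shift₂ = NatSolver.solve-∀
    lenV₂ : length (V ρ ++ Vxy) ≡ suc (r + suc m) + suc q
    lenV₂ = trans (length-++ (V ρ)) (trans (cong (_+ 2) lenV) (shift₂ (r + suc m) q))
      where
      shift₂ : ∀ a r → a + r + 2 ≡ suc a + suc r
      shift₂ = NatSolver.solve-∀
    few : ∀ {a l} bs → a ≤ count false bs → length bs ≡ a + l → count true bs ≤ l
    few {a} {l} bs a≤ eq = +-cancelˡ-≤ a _ l (subst (a + count true bs ≤_) (trans (count-not false bs) eq) (+-monoˡ-≤ (count true bs) a≤))
    tρ≥ : q + suc m ≤ count true (P ρ)
    tρ≥ = prefix-count true p₁ (P ρ) (trans (sym eqp₁) P≡) q≤p₁ p₁≤r lenP
    tρ₂≥ : suc (q + suc m) ≤ count true (P ρ) + (bit (posE x) + bit (posE y))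
    tρ₂≥ = subst (suc (q + suc m) ≤_) (trans (count-++ true (P ρ) Pxy) (cong (λ c → count true (P ρ) + c) (count-pair (posE x) (posE y))))
      (prefix-count true p₂ (P ρ ++ Pxy) (trans (sym eqp₂) P≡₂) q<p₂ p₂≤r lenP₂)
    sρ≤ : count true (V ρ) ≤ q
    sρ≤ = few (V ρ) (prefix-count false v₁ (V ρ) (trans (sym eqv₁) V≡) r≤v₁ v₁≤q lenV) lenV
    sρ₂≤ : count true (V ρ) + (bit (valE x) + bit (valE y)) ≤ suc q
    sρ₂≤ = subst (_≤ suc q) (trans (count-++ true (V ρ) Vxy) (cong (λ c → count true (V ρ) + c) (count-pair (valE x) (valE y))))
      (few (V ρ ++ Vxy) (prefix-count false v₂ (V ρ ++ Vxy) (trans (sym eqv₂) V≡₂) r<v₂ v₂≤q lenV₂) lenV₂)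

-- Labelled entries matched with a pattern

module _ {A : Set} where

  zip-fst : (xs : List A) (ts : List ℕ) → length xs ≡ length ts → map proj₁ (zip xs ts) ≡ xs
  zip-fst [] [] _ = refl
  zip-fst (x ∷ xs) (t ∷ ts) eq = cong (x ∷_) (zip-fst xs ts (suc-injective eq))

  zip-snd : (xs : List A) (ts : List ℕ) → length xs ≡ length ts → map proj₂ (zip xs ts) ≡ ts
  zip-snd [] [] _ = refl
  zip-snd (x ∷ xs) (t ∷ ts) eq = cong (t ∷_) (zip-snd xs ts (suc-injective eq))

  zip-map : {B : Set} (g : A → B) (xs : List A) (ts : List ℕ) → zip (map g xs) ts ≡ map (λ { (x , t) → g x , t }) (zip xs ts)
  zip-map g [] ts = refl
  zip-map g (x ∷ xs) [] = refl
  zip-map g (x ∷ xs) (t ∷ ts) = cong (_ ∷_) (zip-map g xs ts)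

Matched : Set
Matched = (Bool × ℕ) × ℕ

strip : Matched → ℕ × ℕ
strip ((_ , x) , t) = x , t

-- An inversion of the pattern is one of the word, and there it runs from a maximum to a
-- non-maximum. This is how the pattern reveals labels.
Compatible : Matched → Matched → Set
Compatible p q = proj₂ q < proj₂ p → proj₁ (proj₁ p) ≡ true × proj₁ (proj₁ q) ≡ false

compatible : ∀ {p q} → Ordered (proj₁ p) (proj₁ q) → SameOrder (strip p) (strip q) → Compatible p q
compatible (inj₁ x<y) (_ , inv) u<t = contradiction (inv u<t) (<-asym x<y)
compatible (inj₂ l) _ _ = l

match : ∀ {w τ} → AllPairs Ordered w → All (λ p → 0 < proj₂ p) w → Contains (entries w) τ →
  ∃ λ z → map proj₁ z ⊆ w × map proj₂ z ≡ τ × AllPairs Compatible z × (∀ c → ∃ λ v → Threshold c v (map strip z))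
match {w} {τ} ord pos (s , s⊆ , iso)
  with z , z⊆ , refl ← ⊆-map⁻ proj₂ w s⊆
  with len , same ← orderIso⁻ (entries z) τ iso
  with len′ ← trans (sym (length-map proj₂ z)) len =
  zip z τ , subst (_⊆ w) (sym fst≡) z⊆ , zip-snd z τ len′ ,
  AllPairs.zipWith (λ { {p} {q} (o , s) → compatible {p} {q} o s }) (AllPairsₚ.map⁻ (subst (AllPairs Ordered) (sym fst≡) (AllPairs-resp-⊆ z⊆ ord)) , AllPairsₚ.map⁻ same′) ,
  λ c → let v , th , _ = threshold-least c (map strip (zip z τ)) same′ pos′ in v , th
  where
  fst≡ = zip-fst z τ len′
  pos′ : All (λ p → 0 < proj₁ p) (map strip (zip z τ))
  pos′ = (Allₚ.map⁺ (Allₚ.map⁻ {f = proj₁} (subst (All (λ p → 0 < proj₂ p)) (sym fst≡) (All-resp-⊆ z⊆ pos))))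
  same′ : AllPairs SameOrder (map strip (zip z τ))
  same′ = subst (AllPairs SameOrder) (zip-map proj₂ z τ) same

module _ {m w π} (m≥1 : 1 ≤ m) (c : Codes w π) (path : Path (suc m) 0 flatE π) where

  private
    before-bound : ∀ u v → w ≡ u ++ v → ∀ k {x xs n} → suc (length xs) ≡ n → x ∷ xs ⊆ u → All (Marked true (k <_)) (x ∷ xs) →
      count true (take k (V π)) + n ≤ count true (labels u)
    before-bound u v refl k refl s a = subst (_ ≤_) (length-entriesOf true u) (many-before u v (Codes.codes-entries c) k true s a)

    after-bound : ∀ u v → w ≡ u ++ v → ∀ k {x xs n} → suc (length xs) ≡ n → x ∷ xs ⊆ v → All (Marked false (_≤ k)) (x ∷ xs) →
      count false (labels u) + n ≤ count false (take k (V π))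
    after-bound u v refl k {n = n} refl s a = subst (λ l → l + n ≤ count false (take k (V π))) (length-entriesOf false u)
      (many-after u v (Codes.codes-entries c) k false s a)

    length-∷ʳ : ∀ {A : Set} (xs : List A) {x n} → length xs ≡ n → length (xs ++ x ∷ []) ≡ suc n
    length-∷ʳ xs refl = trans (length-++ xs) (+-comm (length xs) 1)

  -- Two position cuts, two value cuts and two labels give the eight bounds of `crossing`. Some of
  -- them count `us` or `ls` alone, which are nonempty because m ≥ 1.
  blocks-impossible : ∀ {w₁ wₘ w₂} → w ≡ w₁ ++ wₘ ++ w₂ → ∀ i j {a us top one ls b} →
    length us ≡ m → length ls ≡ m →
    a ∷ us ⊆ w₁ → top ∷ [] ⊆ wₘ → one ∷ [] ⊆ wₘ → ls ++ b ∷ [] ⊆ w₂ →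
    All (Marked true (i <_)) (a ∷ us ++ top ∷ []) → All (Marked true (j <_)) (us ++ top ∷ []) →
    All (Marked false (_≤ i)) (one ∷ ls) → All (Marked false (_≤ j)) (one ∷ ls ++ b ∷ []) → ⊥
  blocks-impossible {w₁} {wₘ} {w₂} w≡ i j {a} {u ∷ us} {top} {one} {l ∷ ls} {b} |us| |ls| before mid₁ mid₂ after hi₁ hi₂ lo₁ lo₂ =
    crossing {p₁ = labels w₁} {p₂ = labels (w₁ ++ wₘ)} {v₁ = take i (V π)} {v₂ = take j (V π)} path
      (trans (sym (Codes.codes-labels c)) (trans (cong labels w≡) (map-++ proj₁ w₁ (wₘ ++ w₂))))
      (trans (sym (Codes.codes-labels c)) (trans (cong labels w≡₂) (map-++ proj₁ (w₁ ++ wₘ) w₂)))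
      (sym (take++drop≡id i (V π))) (sym (take++drop≡id j (V π)))
      (before-bound w₁ _ w≡ i (cong suc |us|) before (Allₚ.++⁻ˡ (a ∷ u ∷ us) hi₁))
      (before-bound w₁ _ w≡ j |us| before′ (Allₚ.++⁻ˡ (u ∷ us) hi₂))
      (subst (_≤ count true (labels (w₁ ++ wₘ))) (+-suc _ (suc m))
        (before-bound (w₁ ++ wₘ) _ w≡₂ i (cong suc (length-∷ʳ (u ∷ us) |us|)) (⊆-++⁺ before mid₁) hi₁))
      (before-bound (w₁ ++ wₘ) _ w≡₂ j (length-∷ʳ (u ∷ us) |us|) (⊆-++⁺ before′ mid₁) hi₂)
      (after-bound w₁ _ w≡ i (cong suc |ls|) (⊆-++⁺ mid₂ after′) lo₁)
      (after-bound (w₁ ++ wₘ) _ w≡₂ i |ls| after′ (All.tail lo₁))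
      (subst (_≤ count false (take j (V π))) (+-suc _ (suc m))
        (after-bound w₁ _ w≡ j (cong suc (length-∷ʳ (l ∷ ls) |ls|)) (⊆-++⁺ mid₂ after) lo₂))
      (after-bound (w₁ ++ wₘ) _ w≡₂ j (length-∷ʳ (l ∷ ls) |ls|) after (All.tail lo₂))
    where
    w≡₂ : w ≡ (w₁ ++ wₘ) ++ w₂
    w≡₂ = trans w≡ (sym (++-assoc w₁ wₘ w₂))
    before′ : u ∷ us ⊆ w₁
    before′ = ⊆-trans (a Sublist.∷ʳ ⊆-refl) before
    after′ : l ∷ ls ⊆ w₂
    after′ = ⊆-trans (⊆-++ʳ (b ∷ []) ⊆-refl) after
  blocks-impossible w≡ i j {us = []} refl _ = contradiction m≥1 1+n≰n
  blocks-impossible w≡ i j {ls = []} _ refl = contradiction m≥1 1+n≰n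

ThresholdOf : ℕ → ℕ → Matched → Set
ThresholdOf c v ((_ , x) , t) = (t ≤ c → x ≤ v) × (c < t → v < x)

Labelled : Bool → Matched → Set
Labelled b p = proj₁ (proj₁ p) ≡ b

mark-high : ∀ {c v zs} → All (Labelled true) zs → All (ThresholdOf c v) zs → All (λ p → c < proj₂ p) zs →
  All (Marked true (v <_)) (map proj₁ zs)
mark-high [] [] [] = []
mark-high (l ∷ ls) ((_ , h) ∷ hs) (t ∷ ts) = (l , h t) ∷ mark-high ls hs ts

mark-low : ∀ {c v zs} → All (Labelled false) zs → All (ThresholdOf c v) zs → All (λ p → proj₂ p ≤ c) zs →
  All (Marked false (_≤ v)) (map proj₁ zs)
mark-low [] [] [] = []
mark-low (l ∷ ls) ((h , _) ∷ hs) (t ∷ ts) = (l , h t) ∷ mark-low ls hs ts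

pick-All : ∀ (Q : ℕ → Set) b {x y} → Q x → Q y → Q (pick b x y)
pick-All _ true qx _ = qx
pick-All _ false _ qy = qy

-- What the four patterns share, whichever way k, k + 1 and 1, 2k are arranged. The constants are 1
-- + m = k - 1, 3 + m = k + 1 and m + (4 + m) = 2k.
record Blocks (m : ℕ) (z : List Matched) : Set where
  field
    {a top one b} : Matched
    {us zₘ ls} : List Matched
    z≡ : z ≡ (a ∷ us) ++ zₘ ++ (ls ++ b ∷ [])
    |us| : length us ≡ m
    |ls| : length ls ≡ m
    top∈ : top ∈ zₘ
    one∈ : one ∈ zₘ
    one≡ : proj₂ one ≡ 1
    top≡ : proj₂ top ≡ m + (4 + m)
    a> : suc m < proj₂ a
    us> : All (λ p → 3 + m < proj₂ p) us
    ls≤ : All (λ p → proj₂ p ≤ suc m) ls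
    b≤ : proj₂ b ≤ 3 + m

gon-blocks : ∀ {m} z h e → map proj₂ z ≡ gon m h e → Blocks m z
gon-blocks {m} z h e eq
  with z₁ , zᵣ , refl , eq₁ , eqᵣ ← map-split proj₂ z {pick h (2 + m) (3 + m) ∷ interval (4 + m) m} eq
  with zₘ , z₂ , refl , eqₘ , eq₂ ← map-split proj₂ zᵣ {pick e 1 (m + (4 + m)) ∷ pick e (m + (4 + m)) 1 ∷ []} eqᵣ
  with ls , zb , refl , eqₗ , eq_b ← map-split proj₂ z₂ {interval 2 m} eq₂
  = go z₁ zₘ zb e eq₁ eqₘ eq_b
  where
  go : ∀ z₁ zₘ zb e → map proj₂ z₁ ≡ pick h (2 + m) (3 + m) ∷ interval (4 + m) m →
    map proj₂ zₘ ≡ pick e 1 (m + (4 + m)) ∷ pick e (m + (4 + m)) 1 ∷ [] → map proj₂ zb ≡ pick h (3 + m) (2 + m) ∷ [] →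
    Blocks m (z₁ ++ zₘ ++ ls ++ zb)
  go (a ∷ us) (x ∷ y ∷ []) (b ∷ []) e eq₁ eqₘ eq_b = record
    { z≡ = refl
    ; |us| = trans (sym (length-map proj₂ us)) (trans (cong length (∷-injectiveʳ eq₁)) (length-interval (4 + m) m))
    ; |ls| = trans (sym (length-map proj₂ ls)) (trans (cong length eqₗ) (length-interval 2 m))
    ; top∈ = pick∈ e there′ here′
    ; one∈ = pick∈ e here′ there′
    ; one≡ = one-value e eqₘ
    ; top≡ = top-value e eqₘ
    ; a> = subst (suc m <_) (sym (∷-injectiveˡ eq₁)) (pick-All (suc m <_) h ≤-refl (n≤1+n _))
    ; us> = Allₚ.map⁻ (subst (All (3 + m <_)) (sym (∷-injectiveʳ eq₁)) (interval-≥ (4 + m) m))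
    ; ls≤ = Allₚ.map⁻ (subst (All (_≤ suc m)) (sym eqₗ) (All.map (λ {t} t< → ≤-pred (subst (t <_) (+-comm m 2) t<)) (interval-< 2 m)))
    ; b≤ = subst (_≤ 3 + m) (sym (∷-injectiveˡ eq_b)) (pick-All (_≤ 3 + m) h ≤-refl (n≤1+n _))
    }
    where
    here′ : x ∈ x ∷ y ∷ []
    here′ = here refl
    there′ : y ∈ x ∷ y ∷ []
    there′ = there (here refl)
    pick∈ : ∀ e {p q} → p ∈ x ∷ y ∷ [] → q ∈ x ∷ y ∷ [] → pick e p q ∈ x ∷ y ∷ []
    pick∈ true p _ = p
    pick∈ false _ q = q
    one-value : ∀ e → proj₂ x ∷ proj₂ y ∷ [] ≡ pick e 1 (m + (4 + m)) ∷ pick e (m + (4 + m)) 1 ∷ [] → proj₂ (pick e x y) ≡ 1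
    one-value true eq = ∷-injectiveˡ eq
    one-value false eq = ∷-injectiveˡ (∷-injectiveʳ eq)
    top-value : ∀ e → proj₂ x ∷ proj₂ y ∷ [] ≡ pick e 1 (m + (4 + m)) ∷ pick e (m + (4 + m)) 1 ∷ [] → proj₂ (pick e y x) ≡ m + (4 + m)
    top-value true eq = ∷-injectiveˡ (∷-injectiveʳ eq)
    top-value false eq = ∷-injectiveˡ eq

gon-impossible : ∀ {m w π} → 1 ≤ m → Codes w π → Path (suc m) 0 flatE π → AllPairs Ordered w → ∀ h e →
  ¬ Contains (entries w) (gon m h e)
gon-impossible {m} {w} {π} m≥1 c path ord h e con
  with z , z⊆ , pats , comp , thr ← match ord (Allₚ.map⁻ (perm-positive (codes-↭ c))) con
  -- The values of the word are cut where the pattern values are cut after k - 1 and after k + 1.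
  -- Between the cuts lie only the pattern's first and last entries, whose order is free.
  with v₁ , thr₁ ← thr (suc m)
  with v₂ , thr₂ ← thr (3 + m)
  = contra (gon-blocks z h e pats)
  where
  contra : Blocks m z → ⊥
  contra record { a = a ; top = top ; one = one ; b = b ; us = us ; zₘ = zₘ ; ls = ls ; z≡ = refl ; |us| = |us| ; |ls| = |ls| ; top∈ = top∈
                ; one∈ = one∈ ; one≡ = one≡ ; top≡ = top≡ ; a> = a> ; us> = us> ; ls≤ = ls≤ ; b≤ = b≤ }
    with _ , compᵣ , cross₁ ← AllPairs-++⁻ (a ∷ us) comp
    with _ , _ , crossₘ ← AllPairs-++⁻ zₘ compᵣ
    with w₁ , wᵣ , refl , z₁⊆ , zᵣ⊆ ← ⊆-++⁻ (map proj₁ (a ∷ us)) (subst (_⊆ w) (map-++ proj₁ (a ∷ us) (zₘ ++ ls ++ b ∷ [])) z⊆)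
    with wₘ , w₂ , refl , zₘ⊆ , z₂⊆ ← ⊆-++⁻ (map proj₁ zₘ) (subst (_⊆ wᵣ) (map-++ proj₁ zₘ (ls ++ b ∷ [])) zᵣ⊆)
    with t₁ , tᵣ ← Allₚ.++⁻ (a ∷ us) (Allₚ.map⁻ {f = strip} thr₁)
    with tₘ , t₂ ← Allₚ.++⁻ zₘ tᵣ
    with s₁ , sᵣ ← Allₚ.++⁻ (a ∷ us) (Allₚ.map⁻ {f = strip} thr₂)
    with sₘ , s₂ ← Allₚ.++⁻ zₘ sᵣ =
    blocks-impossible m≥1 c path refl v₁ v₂ (trans (length-map proj₁ us) |us|) (trans (length-map proj₁ ls) |ls|)
      z₁⊆ (⊆-trans (Sublistₚ.map⁺ proj₁ (from∈ top∈)) zₘ⊆) (⊆-trans (Sublistₚ.map⁺ proj₁ (from∈ one∈)) zₘ⊆)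
      (subst (_⊆ w₂) (map-++ proj₁ ls (b ∷ [])) z₂⊆)
      (Allₚ.++⁺ (mark-high labels₁ t₁ high₁) (mark-high (label-top ∷ []) (All.lookup tₘ top∈ ∷ []) (top> (s≤s (m≤n+m m 2)) ∷ [])))
      (Allₚ.++⁺ (mark-high (All.tail labels₁) (All.tail s₁) us>) (mark-high (label-top ∷ []) (All.lookup sₘ top∈ ∷ []) (top> ≤-refl ∷ [])))
      (mark-low (label-one ∷ Allₚ.++⁻ˡ ls labels₂) (All.lookup tₘ one∈ ∷ Allₚ.++⁻ˡ ls t₂) (one≤ (s≤s z≤n) ∷ ls≤))
      (subst (λ l → All (Marked false (_≤ v₂)) (proj₁ one ∷ l)) (map-++ proj₁ ls (b ∷ []))
        (mark-low (label-one ∷ labels₂) (All.lookup sₘ one∈ ∷ s₂) (one≤ (s≤s z≤n) ∷ low₂)))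
    where
    top> : ∀ {c} → c ≤ 3 + m → c < proj₂ top
    top> c≤ = subst (_ <_) (sym top≡) (≤-trans (s≤s c≤) (m≤n+m (4 + m) m))
    one≤ : ∀ {c} → 1 ≤ c → proj₂ one ≤ c
    one≤ 1≤c = subst (_≤ _) (sym one≡) 1≤c
    one∈ʳ : one ∈ zₘ ++ ls ++ b ∷ []
    one∈ʳ = ∈-++⁺ˡ one∈
    high₁ : All (λ p → suc m < proj₂ p) (a ∷ us)
    high₁ = a> ∷ All.map (≤-<-trans (m≤n+m (suc m) 2)) us>
    low₂ : All (λ p → proj₂ p ≤ 3 + m) (ls ++ b ∷ [])
    low₂ = Allₚ.++⁺ (All.map (λ t≤ → ≤-trans t≤ (m≤n+m (suc m) 2)) ls≤) (b≤ ∷ [])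
    -- All labels come from inversions: an entry larger than a later one is a maximum, and an entry
    -- preceded by a larger one is a non-maximum. The first block is compared with the pattern's 1,
    -- the last block with its 2k.
    labels₁ : All (Labelled true) (a ∷ us)
    labels₁ = All.zipWith (λ { (cp , t>) → proj₁ (All.lookup cp one∈ʳ (≤-<-trans (one≤ (s≤s z≤n)) t>)) }) (cross₁ , high₁)
    label-one : Labelled false one
    label-one = proj₂ (All.lookup (All.head cross₁) one∈ʳ (≤-<-trans (one≤ (s≤s z≤n)) a>))
    label-top : Labelled true top
    label-top = proj₁ (All.lookup (All.lookup crossₘ top∈) (∈-++⁺ʳ ls (here refl)) (top> b≤))
    labels₂ : All (Labelled false) (ls ++ b ∷ [])
    labels₂ = All.zipWith (λ { (cp , t≤) → proj₂ (cp (top> t≤)) }) (All.lookup crossₘ top∈ , low₂)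

-- Counting the avoiders

map-unique : {A B : Set} (g : A → B) (xs : List A) → (∀ {x y} → x ∈ xs → y ∈ xs → g x ≡ g y → x ≡ y) → Unique xs → Unique (map g xs)
map-unique g [] _ [] = []
map-unique g (x ∷ xs) inj (x∉ ∷ xs!) =
  All.tabulate (λ y∈ e → let z , z∈ , y≡ = ∈-map⁻ g y∈ in All.lookup x∉ z∈ (inj (here refl) (there z∈) (trans e y≡)))
  ∷ map-unique g xs (λ x∈ y∈ → inj (there x∈) (there y∈)) xs!

module _ (m : ℕ) (m≥1 : 1 ≤ m) where

  private
    k = 2 + m
    K = suc m

    Good : List ℕ → Set
    Good w = T (321-kGonAvoidingᵇ k w)

  labelled-unique : ∀ w v → labels w ≡ labels v → (∀ b → entriesOf b w ≡ entriesOf b v) → w ≡ v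
  labelled-unique [] [] _ _ = refl
  labelled-unique ((true , x) ∷ w) ((true , y) ∷ v) eq es with refl ← ∷-injectiveˡ (es true) =
    cong (_ ∷_) (labelled-unique w v (∷-injectiveʳ eq) (λ { true → ∷-injectiveʳ (es true) ; false → es false }))
  labelled-unique ((false , x) ∷ w) ((false , y) ∷ v) eq es with refl ← ∷-injectiveˡ (es false) =
    cong (_ ∷_) (labelled-unique w v (∷-injectiveʳ eq) (λ { true → es true ; false → ∷-injectiveʳ (es false) }))

  -- This identifies a permutation labelled by its left-to-right maxima with the word decoded from
  -- its path, without comparing maxima and weak excedances directly.
  codes-unique : ∀ {w v π} → Codes w π → Codes v π → w ≡ v
  codes-unique {w} {v} c d =
    labelled-unique w v (trans (Codes.codes-labels c) (sym (Codes.codes-labels d)))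
      (λ b → trans (Codes.codes-entries c b) (sym (Codes.codes-entries d b)))

  word-good : ∀ {π} → Path K 0 flatE π → word π ∈ perms (length π) × Good (word π)
  word-good {π} path =
    ∈-perms⁺ (length π) (codes-↭ codes) ,
    Equivalence.from T-∧
      (kGonAvoiding⁺ m (gon-impossible m≥1 codes path ordered) , avoids⁺ (ordered⇒avoids-321 (labelled π) ordered))
    where
    motzkin = path⇒motzkin path
    codes = labelled-codes motzkin
    ordered = labelled-ordered motzkin

  good⇒path : ∀ {n w} → w ∈ perms n → Good w → ∃ λ π → Path K 0 flatE π × length π ≡ n × w ≡ word π
  good⇒path {n} {w} w∈ good
    with gons , no321 ← Equivalence.to (T-∧ {kGonAvoidingᵇ k w}) good
    with w↭ ← ∈-perms⁻ n w∈
    with π , codes ← encode w↭ (avoids⇒no321 w↭ (avoids⁻ no321)) =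
    π , path ,
    trans (sym (length-interval 1 (length π)))
      (trans (sym (↭-length (codes-↭ codes)))
        (trans (cong length (entries-lr 0 w)) (trans (↭-length w↭) (length-interval 1 n)))) ,
    trans (sym (entries-lr 0 w)) (cong entries (codes-unique codes (labelled-codes (path⇒motzkin path))))
    where
    path : Path K 0 flatE π
    path = lr-path (s≤s z≤n) (perm-positive w↭) codes (λ { g ρ x y σ refl eq bad →
      let h , e , con = bad⇒gon ρ x y σ codes eq bad in
      kGonAvoiding⁻ m gons h e (subst (λ v → Contains v (gon m h e)) (entries-lr 0 w) con) })

  f≡#paths : ∀ n → f k n ≡ #free K 0 n
  f≡#paths n = trans
    (trans (unique∧set⇒length
        (Uniqueₚ.filter⁺ good? (perms-unique n))
        (map-unique word (paths K 0 flatE n)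
          (λ π∈ ρ∈ → word-injective (path⇒motzkin (proj₁ (∈-paths⁻ 0 flatE n π∈))) (path⇒motzkin (proj₁ (∈-paths⁻ 0 flatE n ρ∈))))
          (paths-unique 0 flatE n))
        to from)
      (length-map word (paths K 0 flatE n)))
    (#paths-low (s≤s z≤n) flatE n)
    where
    good? = λ w → T? (321-kGonAvoidingᵇ k w)
    to : ∀ {w} → w ∈ filter good? (perms n) → w ∈ map word (paths K 0 flatE n)
    to w∈ with w∈′ , good ← ∈-filter⁻ good? {xs = perms n} w∈ with π , path , len , refl ← good⇒path {n} w∈′ good =
      ∈-map⁺ word (subst (λ l → π ∈ paths K 0 flatE l) len (∈-paths⁺ path))
    from : ∀ {w} → w ∈ map word (paths K 0 flatE n) → w ∈ filter good? (perms n)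
    from w∈ with π , π∈ , refl ← ∈-map⁻ word w∈ with path , len ← ∈-paths⁻ 0 flatE n π∈ with w∈′ , good ← word-good path =
      ∈-filter⁺ good? (subst (λ l → word π ∈ perms l) len w∈′) good

theorem1p3 : (k : ℕ) → 3 ≤ k → (n : ℕ) → 2 * k ≤ n →
    L k n (2 * k ∸ 2) ≡
    L k (n ∸ 1) (2 * k ∸ 2) ℤ.+ L k (n ∸ 3) (2 * k ∸ 5) ℤ.+ L k (n ∸ 3) (2 * k ∸ 4)
    ℤ.+ L k (n ∸ 4) (2 * k ∸ 5) ℤ.+ L k (n ∸ 4) (2 * k ∸ 4)
theorem1p3 (suc (suc (suc h))) (s≤s (s≤s (s≤s z≤n))) =
  -- The patterns are indexed by m = k - 2, here h + 1, so the condition m ≥ 1 is k ≥ 3.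
  recurrence (3 + h) (s≤s (s≤s (s≤s z≤n))) (f≡#paths (suc h) (s≤s z≤n))
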